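{- (1) $\mathcal{L}(\mathbf{JIDL_1})\cong\mathbf{1}\oplus[(\boldsymbol{\omega}+\mathbf{1})\times\mathbf{2}]$. (2) $\mathbf{JIDL_1}$ and $\mathbf{DStHC}$ are the only two elements of infinite height in the lattice $\mathcal{L}(\mathbf{JIDL_1})$. (3) $\mathbf{V}\in\mathcal{L}^+(\mathbf{JIDL_1})$ is of finite height if and only if $\mathbf{V}$ is either $\mathbf{V(D_2)}$, or $\mathbf{V(C_n^{dp})}$ for some $n\in\mathbb{N}\setminus\{1\}$, or $\mathbf{V(C_m^{dp})}\vee\mathbf{V(D_2)}$ for some $m\in\mathbb{N}\setminus\{1\}$.
   Context: A semi-Heyting algebra is an algebra $\langle L,\vee,\wedge,\to,0,1\rangle$ such that $\langle L,\vee,\wedge,0,1\rangle$ is a bounded lattice and the identities $x\wedge(x\to y)\approx x\wedge y$, $x\wedge(y\to z)\approx x\wedge[(x\wedge y)\to(x\wedge z)]$, $x\to x\approx 1$ hold; it is a Heyting algebra if moreover $(x\wedge y)\to y\approx 1$. Write $x^*:=x\to 0$. A $\mathbf{DQD}$-algebra (dually quasi-De Morgan semi-Heyting algebra) is an algebra $\langle L,\vee,\wedge,\to,{}',0,1\rangle$ whose reduct $\langle L,\vee,\wedge,\to,0,1\rangle$ is a semi-Heyting algebra and which satisfies: $0'\approx 1$ and $1'\approx 0$; $(x\wedge y)'\approx x'\vee y'$; $(x\vee y)''\approx x''\vee y''$; $x''\le x$. $\mathbf{DQD}$ denotes the variety of all $\mathbf{DQD}$-algebras. $\mathbf{JIDL_1}$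 is the subvariety of $\mathbf{DQD}$ defined by the identities $x'\vee(y\to z)\approx(x'\vee y)\to(x'\vee z)$, $(x\to y)\vee(y\to x)\approx 1$, and $x\wedge x'^{*}\approx (x\wedge x'^{*})'^{*}$ (where $z'^*$ means $(z')^*$); in the presence of the first identity, the last is equivalent to the level-1 identity $x\wedge x'^*\approx x\wedge x'^*\wedge x'^*{}'^*$. A dually Stone Heyting chain is a $\mathbf{DQD}$-algebra satisfying $x'\wedge x''\approx 0$ whose semi-Heyting reduct is a Heyting algebra and whose lattice reduct is a chain; $\mathbf{DStHC}$ is the variety generated by all dually Stone Heyting chains. For $n\in\mathbb{N}=\{1,2,\dots\}$, $\mathbf{C_n^{dp}}$ is the (unique up to isomorphism) $n$-element dually Stone Heyting chain. $\mathbf{D_2}$ is the $\mathbf{DQD}$-algebra whose reduct without $'$ is the four-element Boolean algebra $\{0,a,b,1\}$ with its Heyting implication ($x\to y$ is the join of the complement of $x$ with $y$), and with $0'=1$, $1'=0$, $a'=a$, $b'=b$. $\mathbf{V(K)}$ denotes the variety generated by $\mathbf{K}$. $\mathcal{L}(\mathbf{V})$ is the lattice of subvarieties of $\mathbf{V}$ and $\mathcal{L}^+(\mathbf{V})$ the lattice of nontrivial subvarieties of $\mathbf{V}$; $\vee$ between varieties is the join of varieties. $\mathbf{1}$ is the one-element lattice, $\mathbf{2}$ the two-element chain, $\boldsymbol{\omega}+\mathbf{1}$ the chain given by the ordinal $\omega+1$, and $\mathbf{1}\oplus\mathbf{L}$ is the ordinal sum (a new least element placed below $\mathbf{L}$).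 -}

module Defs where

open import Level using (Level; 0ℓ; _⊔_) renaming (suc to lsuc)
open import Data.Bool.Base as Bool using (Bool; true; false; not; if_then_else_)
open import Data.Fin.Base as Fin using (Fin; zero; suc; fromℕ)
import Data.Fin.Properties as Finₚ
open import Data.Nat.Base as ℕ using (ℕ; NonZero)
import Data.Nat.Properties as ℕₚ
import Data.Bool.Properties as Boolₚ
open import Data.Product.Base using (Σ; ∃; _×_; _,_; proj₁; proj₂)
open import Data.Product.Relation.Binary.Pointwise.NonDependent
  using (Pointwise; ×-isPartialOrder)
open import Data.Sum.Base using (_⊎_; inj₁; inj₂; [_,_]′)
open import Relation.Nullary using (¬_; does)
open import Relation.Nullary.Construct.Add.Infimum using (_₋; ⊥₋) renaming ([_] to [_]₋)
open import Relation.Nullary.Construct.Add.Supremum using (_⁺; ⊤⁺) renaming ([_] to [_]⁺)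
open import Relation.Unary using (Pred; _∪_)
open import Relation.Binary.Core using (Rel)
open import Relation.Binary.Structures using (IsEquivalence)
open import Relation.Binary.Lattice using (Lattice; Supremum; Infimum)
open import Relation.Binary.PropositionalEquality as ≡ using (_≡_; cong; cong₂)
import Relation.Binary.Construct.Add.Infimum.NonStrict as Inf
import Relation.Binary.Construct.Add.Infimum.Equality as InfEq
import Relation.Binary.Construct.Add.Supremum.NonStrict as Sup
import Relation.Binary.Construct.Add.Supremum.Equality as SupEq
import Relation.Binary.Construct.NonStrictToStrict as ToStrict
import Algebra.Lattice.Structures as AlgLattice
open import Algebra.Lattice.Bundles using (RawLattice)
open import Algebra.Lattice.Morphism.Structures using (IsLatticeIsomorphism)

-- Algebras are setoid-based, so that quotients (e.g. of term algebras)
-- are again algebras.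
record Algebra : Set₁ where
  infix  4 _≈_ _≤_
  infixr 5 _⇒_
  infixr 6 _∨_
  infixr 7 _∧_
  infix  8 _′
  field
    Carrier       : Set
    _≈_           : Rel Carrier 0ℓ
    isEquivalence : IsEquivalence _≈_
    _∨_ _∧_ _⇒_   : Carrier → Carrier → Carrier
    _′            : Carrier → Carrier
    𝟎 𝟏           : Carrier
    ∨-cong        : ∀ {x y u v} → x ≈ y → u ≈ v → (x ∨ u) ≈ (y ∨ v)
    ∧-cong        : ∀ {x y u v} → x ≈ y → u ≈ v → (x ∧ u) ≈ (y ∧ v)
    ⇒-cong        : ∀ {x y u v} → x ≈ y → u ≈ v → (x ⇒ u) ≈ (y ⇒ v)
    ′-cong        : ∀ {x y} → x ≈ y → (x ′) ≈ (y ′)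

  _≤_ : Rel Carrier 0ℓ
  x ≤ y = (x ∧ y) ≈ x

infixr 5 _⇒_
infixr 6 _∨_
infixr 7 _∧_
infix  8 _′ _*
infix  4 _≐_

data Term : Set where
  var         : ℕ → Term
  _∨_ _∧_ _⇒_ : Term → Term → Term
  _′          : Term → Term
  𝟎 𝟏         : Term

_* : Term → Term
t * = t ⇒ 𝟎

record Identity : Set where
  constructor _≐_
  field lhs rhs : Term

module _ (A : Algebra) where
  private module A = Algebra A

  ⟦_⟧ : Term → (ℕ → A.Carrier) → A.Carrier
  ⟦ var i ⟧ ρ = ρ i
  ⟦ s ∨ t ⟧ ρ = ⟦ s ⟧ ρ A.∨ ⟦ t ⟧ ρ
  ⟦ s ∧ t ⟧ ρ = ⟦ s ⟧ ρ A.∧ ⟦ t ⟧ ρ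
  ⟦ s ⇒ t ⟧ ρ = ⟦ s ⟧ ρ A.⇒ ⟦ t ⟧ ρ
  ⟦ t ′ ⟧   ρ = (⟦ t ⟧ ρ) A.′
  ⟦ 𝟎 ⟧     ρ = A.𝟎
  ⟦ 𝟏 ⟧     ρ = A.𝟏

infix 3 _⊨_
infix 4 _∈ᵛ_ _≤ᵛ_ _≋_

_⊨_ : Algebra → Identity → Set
A ⊨ s ≐ t = ∀ ρ → Algebra._≈_ A (⟦ A ⟧ s ρ) (⟦ A ⟧ t ρ)

Theory : Set₂
Theory = Pred Identity (lsuc 0ℓ)

record Variety : Set₂ where
  constructor Mod
  field axioms : Theory

_∈ᵛ_ : Algebra → Variety → Set₁
A ∈ᵛ Mod E = ∀ e → E e → A ⊨ e

-- Varieties are compared as classes of algebras, whatever their axioms.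
_≤ᵛ_ : Rel Variety (lsuc 0ℓ)
V ≤ᵛ W = ∀ A → A ∈ᵛ V → A ∈ᵛ W

_≋_ : Rel Variety (lsuc 0ℓ)
V ≋ W = V ≤ᵛ W × W ≤ᵛ V

-- The variety generated by K: the class of all models of the identities of K.
𝕍 : Pred Algebra (lsuc 0ℓ) → Variety
𝕍 K = Mod λ e → ∀ A → K A → A ⊨ e

𝕍-contains : ∀ K A → K A → A ∈ᵛ 𝕍 K
𝕍-contains K A A∈K e K⊨e = K⊨e A A∈K

𝕍-least : ∀ K W → (∀ A → K A → A ∈ᵛ W) → 𝕍 K ≤ᵛ W
𝕍-least K W K⊆W A A∈𝕍K e e∈W = A∈𝕍K e λ B B∈K → K⊆W B B∈K e e∈W

infixr 6 _∨ᵛ_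
infixr 7 _∧ᵛ_

_∨ᵛ_ : Variety → Variety → Variety
V ∨ᵛ W = 𝕍 ((_∈ᵛ V) ∪ (_∈ᵛ W))

_∧ᵛ_ : Variety → Variety → Variety
Mod E ∧ᵛ Mod F = Mod (E ∪ F)

data TrivialAxiom : Theory where
  x≐y : TrivialAxiom (var 0 ≐ var 1)

Trivial : Variety
Trivial = Mod TrivialAxiom

Subvariety : Variety → Set₂
Subvariety V = Σ Variety (_≤ᵛ V)

𝓛 : Variety → Lattice (lsuc (lsuc 0ℓ)) (lsuc 0ℓ) (lsuc 0ℓ)
𝓛 V = record
  { Carrier = Subvariety V
  ; _≈_ = λ S T → proj₁ S ≋ proj₁ T
  ; _≤_ = λ S T → proj₁ S ≤ᵛ proj₁ T
  ; _∨_ = λ (S , S≤V) (T , T≤V) →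
      S ∨ᵛ T , 𝕍-least _ V λ A → [ S≤V A , T≤V A ]′
  ; _∧_ = λ (S , S≤V) (T , _) →
      S ∧ᵛ T , λ A A∈ → S≤V A λ e e∈S → A∈ e (inj₁ e∈S)
  ; isLattice = record
    { isPartialOrder = record
      { isPreorder = record
        { isEquivalence = record
          { refl  = (λ _ p → p) , (λ _ p → p)
          ; sym   = λ (p , q) → q , p
          ; trans = λ (p , q) (r , s) →
              (λ A a → r A (p A a)) , (λ A a → q A (s A a))
          }
        ; reflexive = proj₁
        ; trans = λ p q A a → q A (p A a)
        }
      ; antisym = _,_
      }
    ; supremum = λ (S , _) (T , _) →
        (λ A a → 𝕍-contains _ A (inj₁ a)) ,
        (λ A a → 𝕍-contains _ A (inj₂ a)) ,
        (λ (U , _) p q → 𝕍-least _ U λ A → [ p A , q A ]′)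
    ; infimum = λ (S , _) (T , _) →
        (λ A a e p → a e (inj₁ p)) ,
        (λ A a e p → a e (inj₂ p)) ,
        (λ _ p q A a e → [ p A a e , q A a e ]′)
    }
  }

private
  x y z : Term
  x = var 0
  y = var 1
  z = var 2

data SemiHeytingAxiom : Theory where
  ∨-comm    : SemiHeytingAxiom (x ∨ y ≐ y ∨ x)
  ∨-assoc   : SemiHeytingAxiom ((x ∨ y) ∨ z ≐ x ∨ (y ∨ z))
  ∧-comm    : SemiHeytingAxiom (x ∧ y ≐ y ∧ x)
  ∧-assoc   : SemiHeytingAxiom ((x ∧ y) ∧ z ≐ x ∧ (y ∧ z))
  ∨-absorbs : SemiHeytingAxiom (x ∨ (x ∧ y) ≐ x)
  ∧-absorbs : SemiHeytingAxiom (x ∧ (x ∨ y) ≐ x)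
  𝟎-least   : SemiHeytingAxiom (𝟎 ∧ x ≐ 𝟎)
  𝟏-great   : SemiHeytingAxiom (x ∧ 𝟏 ≐ x)
  sh₁       : SemiHeytingAxiom (x ∧ (x ⇒ y) ≐ x ∧ y)
  sh₂       : SemiHeytingAxiom (x ∧ (y ⇒ z) ≐ x ∧ ((x ∧ y) ⇒ (x ∧ z)))
  sh₃       : SemiHeytingAxiom (x ⇒ x ≐ 𝟏)

data DQDAxiom : Theory where
  semiHeyting : ∀ {e} → SemiHeytingAxiom e → DQDAxiom e
  𝟎′          : DQDAxiom (𝟎 ′ ≐ 𝟏)
  𝟏′          : DQDAxiom (𝟏 ′ ≐ 𝟎)
  ∧-′         : DQDAxiom ((x ∧ y) ′ ≐ x ′ ∨ y ′)
  ∨-′′        : DQDAxiom (((x ∨ y) ′) ′ ≐ (x ′) ′ ∨ (y ′) ′)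
  ′′-≤        : DQDAxiom ((x ′) ′ ∧ x ≐ (x ′) ′)

DQD : Variety
DQD = Mod DQDAxiom

data JIDL₁Axiom : Theory where
  dqd    : ∀ {e} → DQDAxiom e → JIDL₁Axiom e
  jid    : JIDL₁Axiom (x ′ ∨ (y ⇒ z) ≐ (x ′ ∨ y) ⇒ (x ′ ∨ z))
  linear : JIDL₁Axiom ((x ⇒ y) ∨ (y ⇒ x) ≐ 𝟏)
  level₁ : JIDL₁Axiom (x ∧ (x ′) * ≐ ((x ∧ (x ′) *) ′) *)

JIDL₁ : Variety
JIDL₁ = Mod JIDL₁Axiom

record IsDStHChain (A : Algebra) : Set₁ where
  private module A = Algebra A
  field
    isDQD       : A ∈ᵛ DQD
    isDualStone : A ⊨ x ′ ∧ (x ′) ′ ≐ 𝟎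
    isHeyting   : A ⊨ (x ∧ y) ⇒ y ≐ 𝟏
    isChain     : ∀ a b → a A.≤ b ⊎ b A.≤ a

DStHC : Variety
DStHC = 𝕍 IsDStHChain

lattice-reduct : ∀ A → A ∈ᵛ DQD →
  AlgLattice.IsLattice (Algebra._≈_ A) (Algebra._∨_ A) (Algebra._∧_ A)
lattice-reduct A A∈DQD = record
  { isEquivalence = Algebra.isEquivalence A
  ; ∨-comm     = λ a b → A∈DQD _ (semiHeyting ∨-comm) (env a b b)
  ; ∨-assoc    = λ a b c → A∈DQD _ (semiHeyting ∨-assoc) (env a b c)
  ; ∨-cong     = Algebra.∨-cong A
  ; ∧-comm     = λ a b → A∈DQD _ (semiHeyting ∧-comm) (env a b b)
  ; ∧-assoc    = λ a b c → A∈DQD _ (semiHeyting ∧-assoc) (env a b c)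
  ; ∧-cong     = Algebra.∧-cong A
  ; absorptive = (λ a b → A∈DQD _ (semiHeyting ∨-absorbs) (env a b b))
               , (λ a b → A∈DQD _ (semiHeyting ∧-absorbs) (env a b b))
  }
  where
  env : (a b c : Algebra.Carrier A) → ℕ → Algebra.Carrier A
  env a b c 0 = a
  env a b c 1 = b
  env a b c _ = c

-- In a dually Stone chain x ′ is the dual pseudocomplement of x, so it is
-- 0 at the top element and 1 elsewhere.
Cᵈᵖ : (n : ℕ) → .{{NonZero n}} → Algebra
Cᵈᵖ (ℕ.suc m) = record
  { Carrier       = Fin (ℕ.suc m)
  ; _≈_           = _≡_
  ; isEquivalence = ≡.isEquivalence
  ; _∨_    = λ a b → if does (a Finₚ.≤? b) then b else a
  ; _∧_    = λ a b → if does (a Finₚ.≤? b) then a else b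
  ; _⇒_    = λ a b → if does (a Finₚ.≤? b) then fromℕ m else b
  ; _′     = λ a → if does (a Finₚ.≟ fromℕ m) then zero else fromℕ m
  ; 𝟎      = zero
  ; 𝟏      = fromℕ m
  ; ∨-cong = cong₂ _
  ; ∧-cong = cong₂ _
  ; ⇒-cong = cong₂ _
  ; ′-cong = cong _
  }

-- The four-element Boolean algebra is Bool × Bool, with atoms
-- a = (true , false) and b = (false , true); complementing both components
-- and swapping them fixes a and b and exchanges 0 and 1.
D₂ : Algebra
D₂ = record
  { Carrier       = Bool × Bool
  ; _≈_           = _≡_
  ; isEquivalence = ≡.isEquivalence
  ; _∨_    = λ (p , q) (r , s) → (p Bool.∨ r) , (q Bool.∨ s)
  ; _∧_    = λ (p , q) (r , s) → (p Bool.∧ r) , (q Bool.∧ s)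
  ; _⇒_    = λ (p , q) (r , s) → (not p Bool.∨ r) , (not q Bool.∨ s)
  ; _′     = λ (p , q) → not q , not p
  ; 𝟎      = false , false
  ; 𝟏      = true , true
  ; ∨-cong = cong₂ _
  ; ∧-cong = cong₂ _
  ; ⇒-cong = cong₂ _
  ; ′-cong = cong _
  }

private variable c c′ ℓ₁ ℓ₁′ ℓ₂ ℓ₂′ : Level

𝟏⊕_ : Lattice c ℓ₁ ℓ₂ → Lattice c (c ⊔ ℓ₁) (c ⊔ ℓ₂)
𝟏⊕_ L = record
  { Carrier = L.Carrier ₋
  ; _≈_ = _≈₋_
  ; _≤_ = _≤₋_
  ; _∨_ = join
  ; _∧_ = meet
  ; isLattice = record
    { isPartialOrder = ≤₋-isPartialOrder L.isPartialOrder
    ; supremum = sup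
    ; infimum  = inf
    }
  }
  where
  module L = Lattice L
  open Inf L._≤_
  open InfEq L._≈_ using (_≈₋_)

  join meet : L.Carrier ₋ → L.Carrier ₋ → L.Carrier ₋
  join ⊥₋     b      = b
  join a      ⊥₋     = a
  join [ a ]₋ [ b ]₋ = [ a L.∨ b ]₋
  meet [ a ]₋ [ b ]₋ = [ a L.∧ b ]₋
  meet _      _      = ⊥₋

  ≤-refl : ∀ {a} → a ≤₋ a
  ≤-refl {⊥₋}     = ⊥₋≤ _
  ≤-refl {[ a ]₋} = [ L.refl ]

  sup : Supremum _≤₋_ join
  sup ⊥₋     b      = (⊥₋≤ _) , ≤-refl , λ _ _ q → q
  sup [ a ]₋ ⊥₋     = ≤-refl , (⊥₋≤ _) , λ _ p _ → p
  sup [ a ]₋ [ b ]₋ = [ L.x≤x∨y a b ] , [ L.y≤x∨y a b ] , λ where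
    [ _ ]₋ [ p ] [ q ] → [ L.∨-least p q ]

  inf : Infimum _≤₋_ meet
  inf ⊥₋     b      = (⊥₋≤ _) , (⊥₋≤ _) , λ _ p _ → p
  inf [ a ]₋ ⊥₋     = (⊥₋≤ _) , (⊥₋≤ _) , λ _ _ q → q
  inf [ a ]₋ [ b ]₋ = [ L.x∧y≤x a b ] , [ L.x∧y≤y a b ] , λ where
    ⊥₋     _     _     → ⊥₋≤ _
    [ _ ]₋ [ p ] [ q ] → [ L.∧-greatest p q ]

_⊕𝟏 : Lattice c ℓ₁ ℓ₂ → Lattice c (c ⊔ ℓ₁) (c ⊔ ℓ₂)
_⊕𝟏 L = record
  { Carrier = L.Carrier ⁺
  ; _≈_ = _≈⁺_
  ; _≤_ = _≤⁺_
  ; _∨_ = join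
  ; _∧_ = meet
  ; isLattice = record
    { isPartialOrder = ≤⁺-isPartialOrder L.isPartialOrder
    ; supremum = sup
    ; infimum  = inf
    }
  }
  where
  module L = Lattice L
  open Sup L._≤_
  open SupEq L._≈_ using (_≈⁺_)

  join meet : L.Carrier ⁺ → L.Carrier ⁺ → L.Carrier ⁺
  join [ a ]⁺ [ b ]⁺ = [ a L.∨ b ]⁺
  join _      _      = ⊤⁺
  meet ⊤⁺     b      = b
  meet a      ⊤⁺     = a
  meet [ a ]⁺ [ b ]⁺ = [ a L.∧ b ]⁺

  ≤-refl : ∀ {a} → a ≤⁺ a
  ≤-refl {⊤⁺}     = _ ≤⊤⁺
  ≤-refl {[ a ]⁺} = [ L.refl ]

  sup : Supremum _≤⁺_ join
  sup ⊤⁺     b      = (_ ≤⊤⁺) , (_ ≤⊤⁺) , λ _ p _ → p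
  sup [ a ]⁺ ⊤⁺     = (_ ≤⊤⁺) , (_ ≤⊤⁺) , λ _ _ q → q
  sup [ a ]⁺ [ b ]⁺ = [ L.x≤x∨y a b ] , [ L.y≤x∨y a b ] , λ where
    ⊤⁺     _     _     → _ ≤⊤⁺
    [ _ ]⁺ [ p ] [ q ] → [ L.∨-least p q ]

  inf : Infimum _≤⁺_ meet
  inf ⊤⁺     b      = (_ ≤⊤⁺) , ≤-refl , λ _ _ q → q
  inf [ a ]⁺ ⊤⁺     = ≤-refl , (_ ≤⊤⁺) , λ _ p _ → p
  inf [ a ]⁺ [ b ]⁺ = [ L.x∧y≤x a b ] , [ L.x∧y≤y a b ] , λ where
    [ _ ]⁺ [ p ] [ q ] → [ L.∧-greatest p q ]

infixr 2 _×ᴸ_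

_×ᴸ_ : Lattice c ℓ₁ ℓ₂ → Lattice c′ ℓ₁′ ℓ₂′ →
       Lattice (c ⊔ c′) (ℓ₁ ⊔ ℓ₁′) (ℓ₂ ⊔ ℓ₂′)
L ×ᴸ M = record
  { Carrier = L.Carrier × M.Carrier
  ; _≈_ = Pointwise L._≈_ M._≈_
  ; _≤_ = Pointwise L._≤_ M._≤_
  ; _∨_ = λ (a , b) (a′ , b′) → (a L.∨ a′) , (b M.∨ b′)
  ; _∧_ = λ (a , b) (a′ , b′) → (a L.∧ a′) , (b M.∧ b′)
  ; isLattice = record
    { isPartialOrder = ×-isPartialOrder L.isPartialOrder M.isPartialOrder
    ; supremum = λ (a , b) (a′ , b′) →
        (L.x≤x∨y a a′ , M.x≤x∨y b b′) ,
        (L.y≤x∨y a a′ , M.y≤x∨y b b′) ,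
        λ _ (p , q) (r , s) → L.∨-least p r , M.∨-least q s
    ; infimum = λ (a , b) (a′ , b′) →
        (L.x∧y≤x a a′ , M.x∧y≤x b b′) ,
        (L.x∧y≤y a a′ , M.x∧y≤y b b′) ,
        λ _ (p , q) (r , s) → L.∧-greatest p r , M.∧-greatest q s
    }
  }
  where
  module L = Lattice L
  module M = Lattice M

ω : Lattice 0ℓ 0ℓ 0ℓ
ω = record
  { Carrier = ℕ ; _≈_ = _≡_ ; _≤_ = ℕ._≤_ ; _∨_ = ℕ._⊔_ ; _∧_ = ℕ._⊓_
  ; isLattice = record
    { isPartialOrder = ℕₚ.≤-isPartialOrder
    ; supremum = λ m n → ℕₚ.m≤m⊔n m n , ℕₚ.m≤n⊔m m n , λ _ → ℕₚ.⊔-lub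
    ; infimum  = λ m n → ℕₚ.m⊓n≤m m n , ℕₚ.m⊓n≤n m n , λ _ → ℕₚ.⊓-glb
    }
  }

𝟐 : Lattice 0ℓ 0ℓ 0ℓ
𝟐 = record
  { Carrier = Bool ; _≈_ = _≡_ ; _≤_ = Bool._≤_ ; _∨_ = Bool._∨_ ; _∧_ = Bool._∧_
  ; isLattice = record
    { isPartialOrder = Boolₚ.≤-isPartialOrder
    ; supremum = λ where
        false b     → Boolₚ.≤-minimum b , Bool.b≤b , λ _ _ q → q
        true  b     → Bool.b≤b , Boolₚ.≤-maximum b , λ _ p _ → p
    ; infimum = λ where
        false b     → Bool.b≤b , Boolₚ.≤-minimum b , λ _ p _ → p
        true  b     → Boolₚ.≤-maximum b , Bool.b≤b , λ _ _ q → q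
    }
  }

rawLattice : Lattice c ℓ₁ ℓ₂ → RawLattice c ℓ₁
rawLattice L = record { Carrier = Carrier ; _≈_ = _≈_ ; _∧_ = meet ; _∨_ = join }
  where open Lattice L using (Carrier; _≈_) renaming (_∧_ to meet; _∨_ to join)

infix 1 _≅_

_≅_ : Lattice c ℓ₁ ℓ₂ → Lattice c′ ℓ₁′ ℓ₂′ → Set (c ⊔ c′ ⊔ ℓ₁ ⊔ ℓ₁′)
L ≅ M = ∃ λ f → IsLatticeIsomorphism (rawLattice L) (rawLattice M) f

module _ (L : Lattice c ℓ₁ ℓ₂) where
  private module L = Lattice L
  open ToStrict L._≈_ L._≤_ using (_<_)

  -- A chain a₀ < a₁ < ⋯ < a_k ≤ a, of length k.
  record ChainBelow (a : L.Carrier) (k : ℕ) : Set (c ⊔ ℓ₁ ⊔ ℓ₂) where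
    field
      elem       : Fin (ℕ.suc k) → L.Carrier
      increasing : ∀ {i j} → i Fin.< j → elem i < elem j
      below      : ∀ i → elem i L.≤ a

  FiniteHeight : L.Carrier → Set (c ⊔ ℓ₁ ⊔ ℓ₂)
  FiniteHeight a = ∃ λ N → ∀ k → ChainBelow a k → k ℕ.≤ N

  InfiniteHeight : L.Carrier → Set (c ⊔ ℓ₁ ⊔ ℓ₂)
  InfiniteHeight a = ¬ FiniteHeight a

{-# OPTIONS --safe #-}
module Submission where

-- The proof rests on two facts: every nontrivial simple algebra of JIDL₁ is a
-- dually Stone Heyting chain or isomorphic to D₂, and a subvariety is determined
-- by which of the finite algebras D₂, Cᵈᵖ 2, Cᵈᵖ 3, ... it contains.
--
-- In an algebra of JIDL₁ the prelinearity identity forces the semi-Heyting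
-- reduct to be a Heyting algebra.  The identity for x ′ ∨ (y → z) makes every
-- x ′ complemented, and the level-1 identity says that u = x ∧ x ′* satisfies
-- u = u ′*; such elements are central, with complement u ′, and factor the
-- algebra.  So if s and t are distinct elements of a countable algebra, one can
-- enumerate the elements x and successively pass below x ∧ x ′* or below its
-- complement, always keeping s and t distinct.  The quotient by the resulting
-- filter separates s and t and is simple: x = 1 or x ∧ x ′* = 0 for all x.  No
-- choice principle is needed, because a failing identity already fails in the
-- countable subalgebra generated by the values of its variables.
--
-- In a simple algebra every x satisfies x = 1, x ′ = 1 or x = x ′.  If some c
-- equals c ′, the algebra is {0, c, c *, 1} and is isomorphic to D₂.  Otherwise
-- 1 is join irreducible, so prelinearity makes the algebra a dually Stone
-- Heyting chain.  There every subset with 0 and 1 is a subalgebra, hence a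
-- failing identity fails in a finite subchain.  Consequently V ≤ W holds for
-- V ≤ JIDL₁ as soon as W contains the algebras D₂ and Cᵈᵖ n (n ≥ 2) that are
-- in V (≤ᵛ-by-generators).
--
-- It remains to see which sets of these algebras occur.  Cᵈᵖ n embeds in
-- Cᵈᵖ (n + 1) and Cᵈᵖ 2 embeds in D₂.  Conversely, the identity
-- (x₀ → x₁) ∨ (x₁ → x₂) ∨ ... ∨ (x_{n-1} → x_n) = 1 holds in Cᵈᵖ n and, for
-- n ≥ 2, in D₂, but fails in the longer chains, and x ′ ∧ x ′′ = 0 holds in all
-- dually Stone chains but fails in D₂.  Therefore the subvarieties correspond to
-- the elements of 1 ⊕ [(ω + 1) × 2]: the new least element is the trivial
-- variety, the first coordinate bounds the lengths of the chains, and the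
-- second tells whether D₂ is present.  The correspondence is an order
-- isomorphism, and all three claims are read off from it.

open import Defs
open import Level using (0ℓ) renaming (suc to lsuc)
open import Axiom.ExcludedMiddle using (ExcludedMiddle)
open import Data.Nat.Base using (_+_)
open import Data.Product.Base using (_×_; _,_; ∃; ∃-syntax)
open import Data.Sum.Base using (_⊎_)
open import Function.Bundles using (_⇔_)
open import Relation.Nullary using (¬_)
open import Relation.Unary using (｛_｝)

open import Level using (Lift; lift; lower)
open import Data.Bool.Base as Bool using (Bool; true; false; not; if_then_else_)
import Data.Bool.Properties as Boolₚ
open import Data.Fin.Base as Fin using (Fin; zero; suc; fromℕ; fromℕ<)
import Data.Fin.Properties as Finₚ
open import Data.List.Base using (List; []; _∷_; _++_; map; cartesianProductWith)
open import Data.List.Membership.Propositional using (_∈_)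
open import Data.List.Membership.Propositional.Properties
  using (∈-++⁺ˡ; ∈-++⁺ʳ; ∈-map⁺; ∈-cartesianProductWith⁺)
open import Data.List.Relation.Unary.Any using (here; there)
open import Data.Nat.Base as ℕ using (ℕ; z≤n; s≤s)
import Data.Nat.Properties as ℕₚ
open import Data.Product.Base using (Σ; proj₁; proj₂)
open import Data.Sum.Base as Sum using (inj₁; inj₂; [_,_]′)
open import Function.Bundles using (mk⇔; Equivalence)
open import Relation.Nullary using (yes; no)
open import Relation.Nullary.Decidable using (dec-true; dec-false; map′; toSum; decidable-stable)
open import Relation.Nullary.Negation using (contradiction)
open import Relation.Nullary.Construct.Add.Infimum using (⊥₋) renaming ([_] to [_]₋)
open import Relation.Nullary.Construct.Add.Supremum using (⊤⁺) renaming ([_] to [_]⁺)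
open import Relation.Binary.Bundles using (Setoid; TotalOrder)
open import Relation.Binary.PropositionalEquality as ≡ using (_≡_)
open import Relation.Binary.Structures using (IsEquivalence)
import Algebra.Lattice.Bundles as AlgLattice
import Algebra.Lattice.Construct.NaturalChoice.MinMaxOp as MinMaxOp
import Algebra.Lattice.Properties.Lattice as AlgLatticeₚ
import Algebra.Lattice.Structures as AlgLatticeStructures
import Relation.Binary.Construct.Add.Infimum.NonStrict as Inf
import Relation.Binary.Construct.Add.Supremum.NonStrict as Sup
import Relation.Binary.Lattice as Order
open import Relation.Binary.Lattice using (Lattice)
import Relation.Binary.Lattice.Properties.BoundedJoinSemilattice as BoundedJoinₚ
import Relation.Binary.Lattice.Properties.BoundedLattice as Boundedₚ
import Relation.Binary.Lattice.Properties.BoundedMeetSemilattice as BoundedMeetₚ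
import Relation.Binary.Lattice.Properties.HeytingAlgebra as Heytingₚ
import Relation.Binary.Lattice.Properties.JoinSemilattice as Joinₚ
import Relation.Binary.Lattice.Properties.MeetSemilattice as Meetₚ
import Relation.Binary.Reasoning.Setoid as ≈-Reasoning

-- Identities and embeddings

setoid : Algebra → Setoid 0ℓ 0ℓ
setoid A = record { isEquivalence = Algebra.isEquivalence A }

-- An injective homomorphism of algebras.
record Embedding (A B : Algebra) : Set where
  private
    module A = Algebra A
    module B = Algebra B
  field
    to        : A.Carrier → B.Carrier
    cong      : ∀ {x y} → x A.≈ y → to x B.≈ to y
    injective : ∀ {x y} → to x B.≈ to y → x A.≈ y
    ∨-homo    : ∀ x y → to (x A.∨ y) B.≈ to x B.∨ to y
    ∧-homo    : ∀ x y → to (x A.∧ y) B.≈ to x B.∧ to y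
    ⇒-homo    : ∀ x y → to (x A.⇒ y) B.≈ (to x B.⇒ to y)
    ′-homo    : ∀ x → to (x A.′) B.≈ (to x) B.′
    𝟎-homo    : to A.𝟎 B.≈ B.𝟎
    𝟏-homo    : to A.𝟏 B.≈ B.𝟏

module _ {A B : Algebra} (h : Embedding A B) where
  private
    module A = Algebra A
    module B = Algebra B
  open Embedding h
  open ≈-Reasoning (setoid B)

  ⟦⟧-homo : ∀ t ρ → to (⟦ A ⟧ t ρ) B.≈ ⟦ B ⟧ t (λ i → to (ρ i))
  ⟦⟧-homo (var i) ρ = begin to (ρ i) ∎
  ⟦⟧-homo (s ∨ t) ρ = begin
    to (⟦ A ⟧ s ρ A.∨ ⟦ A ⟧ t ρ)      ≈⟨ ∨-homo _ _ ⟩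
    to (⟦ A ⟧ s ρ) B.∨ to (⟦ A ⟧ t ρ) ≈⟨ B.∨-cong (⟦⟧-homo s ρ) (⟦⟧-homo t ρ) ⟩
    ⟦ B ⟧ (s ∨ t) _                   ∎
  ⟦⟧-homo (s ∧ t) ρ = begin
    to (⟦ A ⟧ s ρ A.∧ ⟦ A ⟧ t ρ)      ≈⟨ ∧-homo _ _ ⟩
    to (⟦ A ⟧ s ρ) B.∧ to (⟦ A ⟧ t ρ) ≈⟨ B.∧-cong (⟦⟧-homo s ρ) (⟦⟧-homo t ρ) ⟩
    ⟦ B ⟧ (s ∧ t) _                   ∎
  ⟦⟧-homo (s ⇒ t) ρ = begin
    to (⟦ A ⟧ s ρ A.⇒ ⟦ A ⟧ t ρ)      ≈⟨ ⇒-homo _ _ ⟩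
    to (⟦ A ⟧ s ρ) B.⇒ to (⟦ A ⟧ t ρ) ≈⟨ B.⇒-cong (⟦⟧-homo s ρ) (⟦⟧-homo t ρ) ⟩
    ⟦ B ⟧ (s ⇒ t) _                   ∎
  ⟦⟧-homo (t ′) ρ = begin
    to (⟦ A ⟧ t ρ A.′)   ≈⟨ ′-homo _ ⟩
    (to (⟦ A ⟧ t ρ)) B.′ ≈⟨ B.′-cong (⟦⟧-homo t ρ) ⟩
    ⟦ B ⟧ (t ′) _        ∎
  ⟦⟧-homo 𝟎 ρ = 𝟎-homo
  ⟦⟧-homo 𝟏 ρ = 𝟏-homo

  ⊨-embedding : ∀ e → B ⊨ e → A ⊨ e
  ⊨-embedding (s ≐ t) B⊨e ρ = injective (begin
    to (⟦ A ⟧ s ρ)             ≈⟨ ⟦⟧-homo s ρ ⟩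
    ⟦ B ⟧ s (λ i → to (ρ i))   ≈⟨ B⊨e _ ⟩
    ⟦ B ⟧ t (λ i → to (ρ i))   ≈⟨ ⟦⟧-homo t ρ ⟨
    to (⟦ A ⟧ t ρ)             ∎)

  ∈ᵛ-embedding : ∀ V → B ∈ᵛ V → A ∈ᵛ V
  ∈ᵛ-embedding V B∈V e e∈V = ⊨-embedding e (B∈V e e∈V)

  -- An identity of A also holds in B at the valuations with values in the image.
  ⊨-image : ∀ s t → A ⊨ s ≐ t → ∀ ρ →
            ⟦ B ⟧ s (λ i → to (ρ i)) B.≈ ⟦ B ⟧ t (λ i → to (ρ i))
  ⊨-image s t A⊨e ρ = begin
    ⟦ B ⟧ s (λ i → to (ρ i))   ≈⟨ ⟦⟧-homo s ρ ⟨
    to (⟦ A ⟧ s ρ)             ≈⟨ cong (A⊨e ρ) ⟩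
    to (⟦ A ⟧ t ρ)             ≈⟨ ⟦⟧-homo t ρ ⟩
    ⟦ B ⟧ t (λ i → to (ρ i))   ∎

-- A strict upper bound on the indices of the variables of a term.
bound : Term → ℕ
bound (var i) = ℕ.suc i
bound (s ∨ t) = bound s ℕ.⊔ bound t
bound (s ∧ t) = bound s ℕ.⊔ bound t
bound (s ⇒ t) = bound s ℕ.⊔ bound t
bound (t ′)   = bound t
bound 𝟎       = 0
bound 𝟏       = 0

module _ (A : Algebra) where
  open Algebra A using (Carrier; _≈_; isEquivalence; ∨-cong; ∧-cong; ⇒-cong; ′-cong)

  private
    Agree : ℕ → (ρ σ : ℕ → Carrier) → Set
    Agree n ρ σ = ∀ i → i ℕ.< n → ρ i ≈ σ i

    restrict : ∀ {m n ρ σ} → m ℕ.≤ n → Agree n ρ σ → Agree m ρ σ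
    restrict m≤n ρ≈σ i i<m = ρ≈σ i (ℕₚ.≤-trans i<m m≤n)

    left : ∀ m n {ρ σ} → Agree (m ℕ.⊔ n) ρ σ → Agree m ρ σ
    left m n = restrict (ℕₚ.m≤m⊔n m n)

    right : ∀ m n {ρ σ} → Agree (m ℕ.⊔ n) ρ σ → Agree n ρ σ
    right m n = restrict (ℕₚ.m≤n⊔m m n)

  ⟦⟧-local : ∀ t {ρ σ} → (∀ i → i ℕ.< bound t → ρ i ≈ σ i) → ⟦ A ⟧ t ρ ≈ ⟦ A ⟧ t σ
  ⟦⟧-local (var i) ρ≈σ = ρ≈σ i ℕₚ.≤-refl
  ⟦⟧-local (s ∨ t) ρ≈σ =
    ∨-cong (⟦⟧-local s (left (bound s) (bound t) ρ≈σ)) (⟦⟧-local t (right (bound s) (bound t) ρ≈σ))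
  ⟦⟧-local (s ∧ t) ρ≈σ =
    ∧-cong (⟦⟧-local s (left (bound s) (bound t) ρ≈σ)) (⟦⟧-local t (right (bound s) (bound t) ρ≈σ))
  ⟦⟧-local (s ⇒ t) ρ≈σ =
    ⇒-cong (⟦⟧-local s (left (bound s) (bound t) ρ≈σ)) (⟦⟧-local t (right (bound s) (bound t) ρ≈σ))
  ⟦⟧-local (t ′)   ρ≈σ = ′-cong (⟦⟧-local t ρ≈σ)
  ⟦⟧-local 𝟎       ρ≈σ = IsEquivalence.refl isEquivalence
  ⟦⟧-local 𝟏       ρ≈σ = IsEquivalence.refl isEquivalence

-- Laws of dually quasi-De Morgan semi-Heyting algebras

-- The valuation of the first three variables.
⟨_,_,_⟩ : {X : Set} → X → X → X → ℕ → X
⟨ a , b , c ⟩ 0 = a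
⟨ a , b , c ⟩ 1 = b
⟨ a , b , c ⟩ _ = c

-- The operation x ′ is written x ᵈ, the order is that of the lattice reduct.
module DQDLaws (A : Algebra) (A∈DQD : A ∈ᵛ DQD) where

  open Algebra A public
    hiding (_≤_)
    renaming (_∨_ to infixr 6 _⊔_; _∧_ to infixr 7 _⊓_; _⇒_ to infixr 5 _⇨_
             ; _′ to infix 9 _ᵈ; 𝟎 to ⊥; 𝟏 to ⊤
             ; ∨-cong to ⊔-cong; ∧-cong to ⊓-cong; ⇒-cong to ⇨-cong; ′-cong to ᵈ-cong)

  private
    algLattice : AlgLattice.Lattice 0ℓ 0ℓ
    algLattice = record { isLattice = lattice-reduct A A∈DQD }

    lattice : Order.Lattice 0ℓ 0ℓ 0ℓ
    lattice = AlgLatticeₚ.∨-∧-orderTheoreticLattice algLattice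

    module L = Order.Lattice lattice

  semi : ∀ {s t} → SemiHeytingAxiom (s ≐ t) → A ⊨ s ≐ t
  semi a = A∈DQD _ (semiHeyting a)

  boundedLattice : Order.BoundedLattice 0ℓ 0ℓ 0ℓ
  boundedLattice = record
    { isBoundedLattice = record
      { isLattice = L.isLattice
      ; maximum   = λ x → L.Eq.sym (semi 𝟏-great ⟨ x , x , x ⟩)
      ; minimum   = λ x → L.Eq.sym (semi 𝟎-least ⟨ x , x , x ⟩)
      }
    }

  open Order.BoundedLattice boundedLattice public
    using (_≤_; joinSemilattice; meetSemilattice; boundedMeetSemilattice;
           boundedJoinSemilattice; antisym; reflexive; maximum; minimum; module Eq)
    renaming (refl to ≤-refl; trans to ≤-trans; x≤x∨y to x≤x⊔y; y≤x∨y to y≤x⊔y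
             ; x∧y≤x to x⊓y≤x; x∧y≤y to x⊓y≤y; ∧-greatest to ⊓-greatest)
  open Joinₚ joinSemilattice public
    using ()
    renaming (∨-comm to ⊔-comm; ∨-monotonic to ⊔-monotonic; x≤y⇒x∨y≈y to x≤y⇒x⊔y≈y
             ; ∨-idempotent to ⊔-idem)
  open Meetₚ meetSemilattice public
    using ()
    renaming (∧-comm to ⊓-comm; ∧-assoc to ⊓-assoc; ∧-monotonic to ⊓-monotonic
             ; y≤x⇒x∧y≈y to y≤x⇒x⊓y≈y; ∧-idempotent to ⊓-idem)
  open Boundedₚ boundedLattice public
    using ()
    renaming (∧-zeroˡ to ⊓-zeroˡ; ∧-zeroʳ to ⊓-zeroʳ; ∨-zeroˡ to ⊔-zeroˡ; ∨-zeroʳ to ⊔-zeroʳ)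
  open BoundedMeetₚ boundedMeetSemilattice public
    using () renaming (identityˡ to ⊓-identityˡ; identityʳ to ⊓-identityʳ)
  open BoundedJoinₚ boundedJoinSemilattice public
    using () renaming (identityˡ to ⊔-identityˡ; identityʳ to ⊔-identityʳ)

  ⊓-⇨ : ∀ x y → x ⊓ (x ⇨ y) ≈ x ⊓ y
  ⊓-⇨ x y = semi sh₁ ⟨ x , y , y ⟩

  ⊓-⇨-⊓ : ∀ x y z → x ⊓ (y ⇨ z) ≈ x ⊓ ((x ⊓ y) ⇨ (x ⊓ z))
  ⊓-⇨-⊓ x y z = semi sh₂ ⟨ x , y , z ⟩

  ⇨-refl : ∀ x → x ⇨ x ≈ ⊤
  ⇨-refl x = semi sh₃ ⟨ x , x , x ⟩

  ⊥ᵈ : ⊥ ᵈ ≈ ⊤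
  ⊥ᵈ = A∈DQD _ 𝟎′ ⟨ ⊥ , ⊥ , ⊥ ⟩

  ⊤ᵈ : ⊤ ᵈ ≈ ⊥
  ⊤ᵈ = A∈DQD _ 𝟏′ ⟨ ⊥ , ⊥ , ⊥ ⟩

  ⊓-ᵈ : ∀ x y → (x ⊓ y) ᵈ ≈ x ᵈ ⊔ y ᵈ
  ⊓-ᵈ x y = A∈DQD _ ∧-′ ⟨ x , y , y ⟩

  ⊔-ᵈᵈ : ∀ x y → (x ⊔ y) ᵈ ᵈ ≈ x ᵈ ᵈ ⊔ y ᵈ ᵈ
  ⊔-ᵈᵈ x y = A∈DQD _ ∨-′′ ⟨ x , y , y ⟩

  xᵈᵈ≤x : ∀ x → x ᵈ ᵈ ≤ x
  xᵈᵈ≤x x = Eq.sym (A∈DQD _ ′′-≤ ⟨ x , x , x ⟩)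

  ᵈ-antitone : ∀ {x y} → x ≤ y → y ᵈ ≤ x ᵈ
  ᵈ-antitone {x} {y} x≤y = ≤-trans (y≤x⊔y (x ᵈ) (y ᵈ))
    (reflexive (Eq.trans (Eq.sym (⊓-ᵈ x y)) (ᵈ-cong (Eq.sym x≤y))))

  xᵈᵈᵈ≈xᵈ : ∀ x → x ᵈ ᵈ ᵈ ≈ x ᵈ
  xᵈᵈᵈ≈xᵈ x = antisym (xᵈᵈ≤x (x ᵈ)) (ᵈ-antitone (xᵈᵈ≤x x))

  ⊤ᵈᵈ : ⊤ ᵈ ᵈ ≈ ⊤
  ⊤ᵈᵈ = Eq.trans (ᵈ-cong ⊤ᵈ) ⊥ᵈ

  ⊤≤⇒≈⊤ : ∀ {x} → ⊤ ≤ x → x ≈ ⊤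
  ⊤≤⇒≈⊤ ⊤≤x = antisym (maximum _) ⊤≤x

  ≤⊥⇒≈⊥ : ∀ {x} → x ≤ ⊥ → x ≈ ⊥
  ≤⊥⇒≈⊥ x≤⊥ = antisym x≤⊥ (minimum _)

  x≤y⇒x⊓y≈x : ∀ {x y} → x ≤ y → x ⊓ y ≈ x
  x≤y⇒x⊓y≈x x≤y = Eq.sym x≤y

  ᵈ≈⊥⇒≈⊤ : ∀ {x} → x ᵈ ≈ ⊥ → x ≈ ⊤
  ᵈ≈⊥⇒≈⊤ {x} xᵈ≈⊥ = ⊤≤⇒≈⊤ (≤-trans (reflexive (Eq.sym (Eq.trans (ᵈ-cong xᵈ≈⊥) ⊥ᵈ))) (xᵈᵈ≤x x))

  -- A prelinear semi-Heyting algebra is a Heyting algebra.  For x ≤ y the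
  -- element y ⇨ x lies below x ⇨ y, because below y ⇨ x the elements x and y
  -- coincide; so the join of the two, which is ⊤, is x ⇨ y.
  prelinear⇒heyting : (∀ x y → (x ⇨ y) ⊔ (y ⇨ x) ≈ ⊤) → ∀ x y → (x ⊓ y) ⇨ y ≈ ⊤
  prelinear⇒heyting prelinear x y = begin
    d      ≈⟨ x≤y⇒x⊔y≈y e≤d ⟨
    e ⊔ d  ≈⟨ prelinear y w ⟩
    ⊤      ∎
    where
    open ≈-Reasoning (setoid A)
    w d e : Carrier
    w = x ⊓ y
    d = w ⇨ y
    e = y ⇨ w
    e⊓y≈w : e ⊓ y ≈ w
    e⊓y≈w = begin
      e ⊓ y     ≈⟨ ⊓-comm e y ⟩
      y ⊓ e     ≈⟨ ⊓-⇨ y w ⟩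
      y ⊓ w     ≈⟨ y≤x⇒x⊓y≈y (x⊓y≤y x y) ⟩
      w         ∎
    e⊓w≈w : e ⊓ w ≈ w
    e⊓w≈w = y≤x⇒x⊓y≈y (≤-trans (reflexive (Eq.sym e⊓y≈w)) (x⊓y≤x e y))
    e≤d : e ≤ d
    e≤d = Eq.sym (begin
      e ⊓ d                         ≈⟨ ⊓-⇨-⊓ e w y ⟩
      e ⊓ ((e ⊓ w) ⇨ (e ⊓ y))       ≈⟨ ⊓-cong Eq.refl (⇨-cong e⊓w≈w e⊓y≈w) ⟩
      e ⊓ (w ⇨ w)                   ≈⟨ ⊓-cong Eq.refl (⇨-refl w) ⟩
      e ⊓ ⊤                         ≈⟨ ⊓-identityʳ e ⟩
      e                             ∎)

-- The order-theoretic Heyting algebra underlying a DQD-algebra whose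
-- semi-Heyting reduct is a Heyting algebra; x ᶜ is its pseudocomplement.
module HeytingLaws (A : Algebra) (A∈DQD : A ∈ᵛ DQD)
  (heyting : A ⊨ (var 0 ∧ var 1) ⇒ var 1 ≐ 𝟏) where

  open DQDLaws A A∈DQD public

  ≤⇒⇨≈⊤ : ∀ {x y} → x ≤ y → x ⇨ y ≈ ⊤
  ≤⇒⇨≈⊤ {x} {y} x≤y = Eq.trans (⇨-cong x≤y Eq.refl) (heyting ⟨ x , y , y ⟩)

  heytingAlgebra : Order.HeytingAlgebra 0ℓ 0ℓ 0ℓ
  heytingAlgebra = record
    { isHeytingAlgebra = record
      { isBoundedLattice = Order.BoundedLattice.isBoundedLattice boundedLattice
      ; exponential = λ w x y → curry w x y , uncurry w x y
      }
    }
    where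
    open ≈-Reasoning (setoid A)
    curry : ∀ w x y → w ⊓ x ≤ y → w ≤ x ⇨ y
    curry w x y w⊓x≤y = Eq.sym (begin
      w ⊓ (x ⇨ y)                ≈⟨ ⊓-⇨-⊓ w x y ⟩
      w ⊓ ((w ⊓ x) ⇨ (w ⊓ y))    ≈⟨ ⊓-cong Eq.refl (≤⇒⇨≈⊤ (⊓-greatest (x⊓y≤x w x) w⊓x≤y)) ⟩
      w ⊓ ⊤                      ≈⟨ ⊓-identityʳ w ⟩
      w                          ∎)
    uncurry : ∀ w x y → w ≤ x ⇨ y → w ⊓ x ≤ y
    uncurry w x y w≤x⇨y = ≤-trans
      (⊓-greatest (x⊓y≤y w x) (≤-trans (x⊓y≤x w x) w≤x⇨y))
      (≤-trans (reflexive (⊓-⇨ x y)) (x⊓y≤y x y))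

  open Order.HeytingAlgebra heytingAlgebra public
    using (transpose-⇨) renaming (transpose-∧ to transpose-⊓)
  open Heytingₚ heytingAlgebra public
    using (y≤x⇨y) renaming (∧-distribˡ-∨ to ⊓-distribˡ-⊔)

  ⊤-⇨ : ∀ x → ⊤ ⇨ x ≈ x
  ⊤-⇨ x = Eq.trans (Eq.sym (⊓-identityˡ _)) (Eq.trans (⊓-⇨ ⊤ x) (⊓-identityˡ x))

  ⊥-⇨ : ∀ x → ⊥ ⇨ x ≈ ⊤
  ⊥-⇨ x = ≤⇒⇨≈⊤ (minimum x)

  infix 9 _ᶜ
  _ᶜ : Carrier → Carrier
  x ᶜ = x ⇨ ⊥

  ᶜ-cong : ∀ {x y} → x ≈ y → x ᶜ ≈ y ᶜ
  ᶜ-cong x≈y = ⇨-cong x≈y Eq.refl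

  x⊓xᶜ≈⊥ : ∀ x → x ⊓ x ᶜ ≈ ⊥
  x⊓xᶜ≈⊥ x = Eq.trans (⊓-⇨ x ⊥) (⊓-zeroʳ x)

  complement-≤ : ∀ {x y z} → x ⊓ y ≈ ⊥ → x ⊔ z ≈ ⊤ → y ≤ z
  complement-≤ {x} {y} {z} x⊓y≈⊥ x⊔z≈⊤ = begin
    y                    ≈⟨ ⊓-identityʳ y ⟨
    y ⊓ ⊤                ≈⟨ ⊓-cong Eq.refl x⊔z≈⊤ ⟨
    y ⊓ (x ⊔ z)          ≈⟨ ⊓-distribˡ-⊔ y x z ⟩
    (y ⊓ x) ⊔ (y ⊓ z)    ≈⟨ ⊔-cong (Eq.trans (⊓-comm y x) x⊓y≈⊥) Eq.refl ⟩
    ⊥ ⊔ (y ⊓ z)          ≈⟨ ⊔-identityˡ _ ⟩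
    y ⊓ z                ∎
    where open ≈-Reasoning (setoid A)

  complement-unique : ∀ {x y z} → x ⊓ y ≈ ⊥ → x ⊔ y ≈ ⊤ → x ⊓ z ≈ ⊥ → x ⊔ z ≈ ⊤ → y ≈ z
  complement-unique xy xy′ xz xz′ = antisym (complement-≤ xy xz′) (complement-≤ xz xy′)

  complement⇒ᶜ : ∀ {x y} → x ⊓ y ≈ ⊥ → x ⊔ y ≈ ⊤ → x ᶜ ≈ y
  complement⇒ᶜ {x} {y} xy xy′ = antisym (complement-≤ (x⊓xᶜ≈⊥ x) xy′)
    (transpose-⇨ (reflexive (Eq.trans (⊓-comm y x) xy)))

-- The finite chains

-- The operations of Cᵈᵖ (m + 1).
module FiniteChain (m : ℕ) where

  open Algebra (Cᵈᵖ (ℕ.suc m)) public using ()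
    renaming (_∨_ to infixr 6 _⊔_; _∧_ to infixr 7 _⊓_; _⇒_ to infixr 5 _⇨_
             ; _′ to infix 9 _ᵈ)

  top : Fin (ℕ.suc m)
  top = fromℕ m

  private
    if-true : ∀ {X : Set} {b} {x y : X} → b ≡ true → (if b then x else y) ≡ x
    if-true ≡.refl = ≡.refl

    if-false : ∀ {X : Set} {b} {x y : X} → b ≡ false → (if b then x else y) ≡ y
    if-false ≡.refl = ≡.refl

  ≤-or-> : ∀ (i j : Fin (ℕ.suc m)) → i Fin.≤ j ⊎ j Fin.< i
  ≤-or-> i j = ℕₚ.≤-<-connex (Fin.toℕ i) (Fin.toℕ j)

  module _ (i j : Fin (ℕ.suc m)) where

    ⊔-≤ : i Fin.≤ j → i ⊔ j ≡ j
    ⊔-≤ i≤j = if-true (dec-true (i Finₚ.≤? j) i≤j)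

    ⊓-≤ : i Fin.≤ j → i ⊓ j ≡ i
    ⊓-≤ i≤j = if-true (dec-true (i Finₚ.≤? j) i≤j)

    ⇨-≤ : i Fin.≤ j → (i ⇨ j) ≡ top
    ⇨-≤ i≤j = if-true (dec-true (i Finₚ.≤? j) i≤j)

    ⇨-> : j Fin.< i → (i ⇨ j) ≡ j
    ⇨-> j<i = if-false (dec-false (i Finₚ.≤? j) (ℕₚ.<⇒≱ j<i))

    ⊔-≥ : j Fin.≤ i → i ⊔ j ≡ i
    ⊔-≥ j≤i with ≤-or-> i j
    ... | inj₁ i≤j = ≡.trans (⊔-≤ i≤j) (Finₚ.≤-antisym j≤i i≤j)
    ... | inj₂ j<i = if-false (dec-false (i Finₚ.≤? j) (ℕₚ.<⇒≱ j<i))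

    ⊓-≥ : j Fin.≤ i → i ⊓ j ≡ j
    ⊓-≥ j≤i with ≤-or-> i j
    ... | inj₁ i≤j = ≡.trans (⊓-≤ i≤j) (Finₚ.≤-antisym i≤j j≤i)
    ... | inj₂ j<i = if-false (dec-false (i Finₚ.≤? j) (ℕₚ.<⇒≱ j<i))

  topᵈ : top ᵈ ≡ zero
  topᵈ = if-true (dec-true (top Finₚ.≟ top) ≡.refl)

  private
    open AlgLatticeStructures (_≡_ {A = Fin (ℕ.suc m)})

    isLattice : IsLattice _⊔_ _⊓_
    isLattice = MinMaxOp.⊔-⊓-isLattice {O = TotalOrder.totalPreorder (Finₚ.≤-totalOrder (ℕ.suc m))}
      (record { _⊓_ = _⊓_ ; x≤y⇒x⊓y≈x = ⊓-≤ _ _ ; x≥y⇒x⊓y≈y = ⊓-≥ _ _ })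
      (record { _⊔_ = _⊔_ ; x≤y⇒x⊔y≈y = ⊔-≤ _ _ ; x≥y⇒x⊔y≈x = ⊔-≥ _ _ })

    open IsLattice isLattice

    ⊓-top : ∀ i → i ⊓ top ≡ i
    ⊓-top i = ⊓-≤ i top (Finₚ.≤fromℕ i)

    ⇨-refl : ∀ i → (i ⇨ i) ≡ top
    ⇨-refl i = ⇨-≤ i i ℕₚ.≤-refl

    ≤-⇨ : ∀ i j → j Fin.≤ (i ⇨ j)
    ≤-⇨ i j with ≤-or-> i j
    ... | inj₁ i≤j = ≡.subst (j Fin.≤_) (≡.sym (⇨-≤ i j i≤j)) (Finₚ.≤fromℕ j)
    ... | inj₂ j<i = Finₚ.≤-reflexive (≡.sym (⇨-> i j j<i))

    ⊓-⇨ : ∀ i j → i ⊓ (i ⇨ j) ≡ i ⊓ j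
    ⊓-⇨ i j with ≤-or-> i j
    ... | inj₁ i≤j rewrite ⇨-≤ i j i≤j | ⊓-≤ i j i≤j = ⊓-top i
    ... | inj₂ j<i rewrite ⇨-> i j j<i = ≡.refl

    <-⊓ : ∀ i j {k : Fin (ℕ.suc m)} → k Fin.< i → k Fin.< j → k Fin.< (i ⊓ j)
    <-⊓ i j {k} k<i k<j with Finₚ.≤-total i j
    ... | inj₁ i≤j = ≡.subst (k Fin.<_) (≡.sym (⊓-≤ i j i≤j)) k<i
    ... | inj₂ j≤i = ≡.subst (k Fin.<_) (≡.sym (⊓-≥ i j j≤i)) k<j

    ⊓-⇨-⊓ : ∀ i j k → i ⊓ (j ⇨ k) ≡ i ⊓ ((i ⊓ j) ⇨ (i ⊓ k))
    ⊓-⇨-⊓ i j k with ≤-or-> i k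
    ⊓-⇨-⊓ i j k | inj₁ i≤k = begin
      i ⊓ (j ⇨ k)               ≡⟨ ⊓-≤ i (j ⇨ k) (ℕₚ.≤-trans i≤k (≤-⇨ j k)) ⟩
      i                         ≡⟨ ⊓-top i ⟨
      i ⊓ top                   ≡⟨ ≡.cong (i ⊓_) (⇨-≤ (i ⊓ j) i i⊓j≤i) ⟨
      i ⊓ ((i ⊓ j) ⇨ i)         ≡⟨ ≡.cong (λ l → i ⊓ ((i ⊓ j) ⇨ l)) (⊓-≤ i k i≤k) ⟨
      i ⊓ ((i ⊓ j) ⇨ (i ⊓ k))   ∎
      where
      open ≡.≡-Reasoning
      i⊓j≤i : (i ⊓ j) Fin.≤ i
      i⊓j≤i with Finₚ.≤-total i j
      ... | inj₁ i≤j = Finₚ.≤-reflexive (⊓-≤ i j i≤j)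
      ... | inj₂ j≤i = ≡.subst (Fin._≤ i) (≡.sym (⊓-≥ i j j≤i)) j≤i
    ⊓-⇨-⊓ i j k | inj₂ k<i with ≤-or-> j k
    ... | inj₁ j≤k rewrite ⇨-≤ j k j≤k | ⊓-≥ i k (ℕₚ.<⇒≤ k<i)
                         | ⊓-≥ i j (ℕₚ.≤-trans j≤k (ℕₚ.<⇒≤ k<i)) | ⇨-≤ j k j≤k = ≡.refl
    ... | inj₂ k<j rewrite ⇨-> j k k<j | ⊓-≥ i k (ℕₚ.<⇒≤ k<i) | ⇨-> (i ⊓ j) k (<-⊓ i j k<i k<j) =
      ≡.sym (⊓-≥ i k (ℕₚ.<⇒≤ k<i))

    zeroᵈ : ∀ m → Algebra._′ (Cᵈᵖ (ℕ.suc m)) zero ≡ fromℕ m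
    zeroᵈ ℕ.zero    = ≡.refl
    zeroᵈ (ℕ.suc _) = ≡.refl

    ᵈ-antitone : ∀ {i j : Fin (ℕ.suc m)} → i Fin.≤ j → j ᵈ Fin.≤ i ᵈ
    ᵈ-antitone {i} {j} i≤j with i Finₚ.≟ top
    ... | no  _      = Finₚ.≤fromℕ (j ᵈ)
    ... | yes ≡.refl rewrite Finₚ.≤-antisym (Finₚ.≤fromℕ j) i≤j | topᵈ = z≤n

    ⊓-ᵈ : ∀ i j → (i ⊓ j) ᵈ ≡ i ᵈ ⊔ j ᵈ
    ⊓-ᵈ i j with Finₚ.≤-total i j
    ... | inj₁ i≤j = ≡.trans (≡.cong _ᵈ (⊓-≤ i j i≤j)) (≡.sym (⊔-≥ _ _ (ᵈ-antitone i≤j)))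
    ... | inj₂ j≤i = ≡.trans (≡.cong _ᵈ (⊓-≥ i j j≤i)) (≡.sym (⊔-≤ _ _ (ᵈ-antitone j≤i)))

    ⊔-ᵈᵈ : ∀ i j → (i ⊔ j) ᵈ ᵈ ≡ i ᵈ ᵈ ⊔ j ᵈ ᵈ
    ⊔-ᵈᵈ i j with Finₚ.≤-total i j
    ... | inj₁ i≤j = ≡.trans (≡.cong (λ k → k ᵈ ᵈ) (⊔-≤ i j i≤j))
                             (≡.sym (⊔-≤ _ _ (ᵈ-antitone (ᵈ-antitone i≤j))))
    ... | inj₂ j≤i = ≡.trans (≡.cong (λ k → k ᵈ ᵈ) (⊔-≥ i j j≤i))
                             (≡.sym (⊔-≥ _ _ (ᵈ-antitone (ᵈ-antitone j≤i))))

    ᵈᵈ≤ : ∀ i → i ᵈ ᵈ Fin.≤ i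
    ᵈᵈ≤ i with i Finₚ.≟ top
    ... | yes ≡.refl = Finₚ.≤fromℕ (zero ᵈ)
    ... | no  _      rewrite topᵈ = z≤n

    dualStone : ∀ i → i ᵈ ⊓ i ᵈ ᵈ ≡ zero
    dualStone i with i Finₚ.≟ top
    ... | yes _ = ⊓-≤ zero (zero ᵈ) z≤n
    ... | no  _ rewrite topᵈ = ⊓-≥ top zero z≤n

    isDQD : Cᵈᵖ (ℕ.suc m) ∈ᵛ DQD
    isDQD _ (semiHeyting ∨-comm)    ρ = IsLattice.∨-comm isLattice (ρ 0) (ρ 1)
    isDQD _ (semiHeyting ∨-assoc)   ρ = IsLattice.∨-assoc isLattice (ρ 0) (ρ 1) (ρ 2)
    isDQD _ (semiHeyting ∧-comm)    ρ = IsLattice.∧-comm isLattice (ρ 0) (ρ 1)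
    isDQD _ (semiHeyting ∧-assoc)   ρ = IsLattice.∧-assoc isLattice (ρ 0) (ρ 1) (ρ 2)
    isDQD _ (semiHeyting ∨-absorbs) ρ = proj₁ (IsLattice.absorptive isLattice) (ρ 0) (ρ 1)
    isDQD _ (semiHeyting ∧-absorbs) ρ = proj₂ (IsLattice.absorptive isLattice) (ρ 0) (ρ 1)
    isDQD _ (semiHeyting 𝟎-least)   ρ = ⊓-≤ zero (ρ 0) z≤n
    isDQD _ (semiHeyting 𝟏-great)   ρ = ⊓-top (ρ 0)
    isDQD _ (semiHeyting sh₁)       ρ = ⊓-⇨ (ρ 0) (ρ 1)
    isDQD _ (semiHeyting sh₂)       ρ = ⊓-⇨-⊓ (ρ 0) (ρ 1) (ρ 2)
    isDQD _ (semiHeyting sh₃)       ρ = ⇨-refl (ρ 0)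
    isDQD _ 𝟎′                      ρ = zeroᵈ m
    isDQD _ 𝟏′                      ρ = topᵈ
    isDQD _ ∧-′                     ρ = ⊓-ᵈ (ρ 0) (ρ 1)
    isDQD _ ∨-′′                    ρ = ⊔-ᵈᵈ (ρ 0) (ρ 1)
    isDQD _ ′′-≤                    ρ = ⊓-≤ _ _ (ᵈᵈ≤ (ρ 0))

    heyting : ∀ i j → ((i ⊓ j) ⇨ j) ≡ top
    heyting i j with Finₚ.≤-total i j
    ... | inj₁ i≤j = ≡.trans (≡.cong (_⇨ j) (⊓-≤ i j i≤j)) (⇨-≤ i j i≤j)
    ... | inj₂ j≤i = ≡.trans (≡.cong (_⇨ j) (⊓-≥ i j j≤i)) (⇨-refl j)

  isDStHChain : IsDStHChain (Cᵈᵖ (ℕ.suc m))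
  isDStHChain = record
    { isDQD       = isDQD
    ; isDualStone = λ ρ → dualStone (ρ 0)
    ; isHeyting   = λ ρ → heyting (ρ 0) (ρ 1)
    ; isChain     = λ i j → Sum.map (⊓-≤ i j) (⊓-≤ j i) (Finₚ.≤-total i j)
    }

-- Dually Stone Heyting chains

module ChainLaws (A : Algebra) (isDStHChain : IsDStHChain A) where

  open IsDStHChain isDStHChain
  open HeytingLaws A isDQD isHeyting public

  total : ∀ x y → x ≤ y ⊎ y ≤ x
  total x y = Sum.map Eq.sym Eq.sym (isChain x y)

  ⊤-or-ᵈ≈⊤ : ∀ x → x ≈ ⊤ ⊎ x ᵈ ≈ ⊤
  ⊤-or-ᵈ≈⊤ x with total (x ᵈ) (x ᵈ ᵈ)
  ... | inj₁ p = inj₁ (ᵈ≈⊥⇒≈⊤ (Eq.trans p (isDualStone (λ _ → x))))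
  ... | inj₂ p = inj₂ (begin
    x ᵈ               ≈⟨ xᵈᵈᵈ≈xᵈ x ⟨
    x ᵈ ᵈ ᵈ           ≈⟨ ᵈ-cong (y≤x⇒x⊓y≈y p) ⟨
    (x ᵈ ⊓ x ᵈ ᵈ) ᵈ   ≈⟨ ᵈ-cong (isDualStone (λ _ → x)) ⟩
    ⊥ ᵈ               ≈⟨ ⊥ᵈ ⟩
    ⊤                 ∎)
    where open ≈-Reasoning (setoid A)

  ≰⇒⇨≈ : ∀ {x y} → ¬ x ≤ y → x ⇨ y ≈ y
  ≰⇒⇨≈ {x} {y} x≰y with total x (x ⇨ y)
  ... | inj₁ x≤x⇨y = contradiction (≤-trans (⊓-greatest ≤-refl x≤x⇨y)
                       (≤-trans (reflexive (⊓-⇨ x y)) (x⊓y≤y x y))) x≰y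
  ... | inj₂ x⇨y≤x = antisym (≤-trans (⊓-greatest x⇨y≤x ≤-refl)
                       (≤-trans (reflexive (⊓-⇨ x y)) (x⊓y≤y x y))) y≤x⇨y

  private
    ⊤ᵈᶜ : ∀ {x} → x ≈ ⊤ → x ᵈ ᶜ ≈ ⊤
    ⊤ᵈᶜ x≈⊤ = Eq.trans (ᶜ-cong (Eq.trans (ᵈ-cong x≈⊤) ⊤ᵈ)) (⇨-refl ⊥)

    ᵈᶜ≈⊥ : ∀ {x} → x ᵈ ≈ ⊤ → x ᵈ ᶜ ≈ ⊥
    ᵈᶜ≈⊥ xᵈ≈⊤ = Eq.trans (ᶜ-cong xᵈ≈⊤) (⊤-⇨ ⊥)

    jid-law : ∀ x y z → x ᵈ ⊔ (y ⇨ z) ≈ (x ᵈ ⊔ y) ⇨ (x ᵈ ⊔ z)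
    jid-law x y z with ⊤-or-ᵈ≈⊤ x
    ... | inj₁ x≈⊤ = Eq.trans (⊥⊔ _) (⇨-cong (Eq.sym (⊥⊔ y)) (Eq.sym (⊥⊔ z)))
      where
      ⊥⊔ : ∀ w → x ᵈ ⊔ w ≈ w
      ⊥⊔ w = Eq.trans (⊔-cong (Eq.trans (ᵈ-cong x≈⊤) ⊤ᵈ) Eq.refl) (⊔-identityˡ w)
    ... | inj₂ xᵈ≈⊤ = Eq.trans (⊤⊔ _) (Eq.sym (Eq.trans (⇨-cong (⊤⊔ y) (⊤⊔ z)) (⇨-refl ⊤)))
      where
      ⊤⊔ : ∀ w → x ᵈ ⊔ w ≈ ⊤
      ⊤⊔ w = Eq.trans (⊔-cong xᵈ≈⊤ Eq.refl) (⊔-zeroˡ w)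

    linear-law : ∀ x y → (x ⇨ y) ⊔ (y ⇨ x) ≈ ⊤
    linear-law x y with total x y
    ... | inj₁ x≤y = Eq.trans (⊔-cong (≤⇒⇨≈⊤ x≤y) Eq.refl) (⊔-zeroˡ _)
    ... | inj₂ y≤x = Eq.trans (⊔-cong Eq.refl (≤⇒⇨≈⊤ y≤x)) (⊔-zeroʳ _)

    level₁-law : ∀ x → x ⊓ x ᵈ ᶜ ≈ (x ⊓ x ᵈ ᶜ) ᵈ ᶜ
    level₁-law x with ⊤-or-ᵈ≈⊤ x
    ... | inj₁ x≈⊤ = Eq.trans w≈⊤ (Eq.sym (⊤ᵈᶜ w≈⊤))
      where
      w≈⊤ : x ⊓ x ᵈ ᶜ ≈ ⊤
      w≈⊤ = Eq.trans (⊓-cong x≈⊤ (⊤ᵈᶜ x≈⊤)) (⊓-identityˡ ⊤)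
    ... | inj₂ xᵈ≈⊤ = Eq.trans w≈⊥ (Eq.sym (ᵈᶜ≈⊥ (Eq.trans (ᵈ-cong w≈⊥) ⊥ᵈ)))
      where
      w≈⊥ : x ⊓ x ᵈ ᶜ ≈ ⊥
      w≈⊥ = Eq.trans (⊓-cong Eq.refl (ᵈᶜ≈⊥ xᵈ≈⊤)) (⊓-zeroʳ x)

  ∈JIDL₁ : A ∈ᵛ JIDL₁
  ∈JIDL₁ _ (dqd a) = isDQD _ a
  ∈JIDL₁ _ jid     = λ ρ → jid-law (ρ 0) (ρ 1) (ρ 2)
  ∈JIDL₁ _ linear  = λ ρ → linear-law (ρ 0) (ρ 1)
  ∈JIDL₁ _ level₁  = λ ρ → level₁-law (ρ 0)

  -- A strictly increasing sequence from ⊥ to ⊤ with m + 1 terms.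
  record Spine (m : ℕ) : Set where
    field
      at         : Fin (ℕ.suc m) → Carrier
      increasing : ∀ {i j} → i Fin.< j → at i ≤ at j × ¬ at j ≤ at i
      bottom     : at zero ≈ ⊥
      top        : at (fromℕ m) ≈ ⊤

  -- In a dually Stone Heyting chain every subset with ⊥ and ⊤ is a subalgebra.
  module _ {m : ℕ} (spine : Spine m) where
    private
      open Spine spine
      module C = FiniteChain m

      mono : ∀ {i j} → i Fin.≤ j → at i ≤ at j
      mono {i} {j} i≤j with C.≤-or-> j i
      ... | inj₁ j≤i = reflexive (Eq.reflexive (≡.cong at (Finₚ.≤-antisym i≤j j≤i)))
      ... | inj₂ i<j = proj₁ (increasing i<j)

      at-cong : ∀ {i j} → i ≡ j → at i ≈ at j
      at-cong i≡j = Eq.reflexive (≡.cong at i≡j)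

      reflects : ∀ {i j} → at i ≤ at j → i Fin.≤ j
      reflects {i} {j} p with C.≤-or-> i j
      ... | inj₁ i≤j = i≤j
      ... | inj₂ j<i = contradiction p (proj₂ (increasing j<i))

      ⊔-homo : ∀ i j → at (i C.⊔ j) ≈ at i ⊔ at j
      ⊔-homo i j with Finₚ.≤-total i j
      ... | inj₁ i≤j = Eq.trans (at-cong (C.⊔-≤ i j i≤j)) (Eq.sym (x≤y⇒x⊔y≈y (mono i≤j)))
      ... | inj₂ j≤i = Eq.trans (at-cong (C.⊔-≥ i j j≤i))
                         (Eq.sym (Eq.trans (⊔-comm _ _) (x≤y⇒x⊔y≈y (mono j≤i))))

      ⊓-homo : ∀ i j → at (i C.⊓ j) ≈ at i ⊓ at j
      ⊓-homo i j with Finₚ.≤-total i j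
      ... | inj₁ i≤j = Eq.trans (at-cong (C.⊓-≤ i j i≤j)) (mono i≤j)
      ... | inj₂ j≤i = Eq.trans (at-cong (C.⊓-≥ i j j≤i)) (Eq.sym (y≤x⇒x⊓y≈y (mono j≤i)))

      ⇨-homo : ∀ i j → at (i C.⇨ j) ≈ at i ⇨ at j
      ⇨-homo i j with C.≤-or-> i j
      ... | inj₁ i≤j = Eq.trans (at-cong (C.⇨-≤ i j i≤j)) (Eq.trans top (Eq.sym (≤⇒⇨≈⊤ (mono i≤j))))
      ... | inj₂ j<i = Eq.trans (at-cong (C.⇨-> i j j<i))
                         (Eq.sym (≰⇒⇨≈ (proj₂ (increasing j<i))))

      ᵈ-homo : ∀ i → at (i C.ᵈ) ≈ at i ᵈ
      ᵈ-homo i with i Finₚ.≟ C.top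
      ... | yes ≡.refl = Eq.trans bottom (Eq.sym (Eq.trans (ᵈ-cong top) ⊤ᵈ))
      ... | no  i≢top  with ⊤-or-ᵈ≈⊤ (at i)
      ...   | inj₂ p = Eq.trans top (Eq.sym p)
      ...   | inj₁ p = contradiction (Finₚ.≤-antisym (Finₚ.≤fromℕ i)
                (reflects (reflexive (Eq.trans top (Eq.sym p))))) i≢top

    spine⇒embedding : Embedding (Cᵈᵖ (ℕ.suc m)) A
    spine⇒embedding = record
      { to        = at
      ; cong      = at-cong
      ; injective = λ p → Finₚ.≤-antisym (reflects (reflexive p)) (reflects (reflexive (Eq.sym p)))
      ; ∨-homo    = ⊔-homo
      ; ∧-homo    = ⊓-homo
      ; ⇒-homo    = ⇨-homo
      ; ′-homo    = ᵈ-homo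
      ; 𝟎-homo    = bottom
      ; 𝟏-homo    = top
      }

  -- A strictly increasing sequence from x to ⊤ with m + 1 terms, as a list.
  data Ascent : Carrier → ℕ → Set where
    end  : ∀ {x} → x ≈ ⊤ → Ascent x 0
    step : ∀ {x y m} → x ≤ y → ¬ y ≤ x → Ascent y m → Ascent x (ℕ.suc m)

  private
    at : ∀ {x m} → Ascent x m → Fin (ℕ.suc m) → Carrier
    at {x} _            zero    = x
    at     (step _ _ p) (suc i) = at p i

    at-≥ : ∀ {x m} (p : Ascent x m) i → x ≤ at p i
    at-≥ p              zero    = ≤-refl
    at-≥ (step x≤y _ p) (suc i) = ≤-trans x≤y (at-≥ p i)

    at-increasing : ∀ {x m} (p : Ascent x m) {i j} → i Fin.< j →
                    at p i ≤ at p j × ¬ at p j ≤ at p i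
    at-increasing (step x≤y y≰x p) {zero}  {suc j} _         =
      ≤-trans x≤y (at-≥ p j) , λ q → y≰x (≤-trans (at-≥ p j) q)
    at-increasing (step _ _ p)     {suc i} {suc j} (s≤s i<j) = at-increasing p i<j

    at-top : ∀ {x m} (p : Ascent x m) → at p (fromℕ m) ≈ ⊤
    at-top (end x≈⊤)    = x≈⊤
    at-top (step _ _ p) = at-top p

    infix 4 _∋_
    _∋_ : ∀ {x m} → Ascent x m → Carrier → Set
    p ∋ y = ∃ λ i → y ≈ at p i

  ascent⇒spine : ∀ {m} → Ascent ⊥ m → Spine m
  ascent⇒spine p = record
    { at = at p ; increasing = at-increasing p ; bottom = Eq.refl ; top = at-top p }

  module _ (em : ExcludedMiddle 0ℓ) where

    private
      insert : ∀ {x m} (p : Ascent x m) y → x ≤ y →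
               ∃ λ n → Σ (Ascent x n) λ q → (q ∋ y) × (∀ z → p ∋ z → q ∋ z)
      insert p@(end x≈⊤) y x≤y =
        _ , p , (zero , antisym (≤-trans (maximum y) (reflexive (Eq.sym x≈⊤))) x≤y) , λ _ z∈p → z∈p
      insert {x} (step {y = w} x≤w w≰x p) y x≤y with em {w ≤ y}
      ... | yes w≤y with insert p y w≤y
      ...   | n , q , (i , y≈) , p⊆q = _ , step x≤w w≰x q , (suc i , y≈) , λ where
              z (zero  , z≈) → zero , z≈
              z (suc j , z≈) → let k , z≈′ = p⊆q z (j , z≈) in suc k , z≈′
      insert {x} (step {y = w} x≤w w≰x p) y x≤y | no w≰y with em {y ≤ x}
      ... | yes y≤x = _ , step x≤w w≰x p , (zero , antisym y≤x x≤y) , λ _ z∈p → z∈p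
      ... | no  y≰x = _ , step x≤y y≰x (step y≤w w≰y p) , (suc zero , Eq.refl) , λ where
              z (zero  , z≈) → zero , z≈
              z (suc j , z≈) → suc (suc j) , z≈
        where
        y≤w : y ≤ w
        y≤w = [ (λ y≤w → y≤w) , (λ w≤y → contradiction w≤y w≰y) ]′ (total y w)

      -- Any finitely many elements lie in a common sequence.
      gather : ¬ ⊤ ≤ ⊥ → ∀ n (ρ : ℕ → Carrier) →
               ∃ λ m → Σ (Ascent ⊥ (ℕ.suc m)) λ p → ∀ i → i ℕ.< n → p ∋ ρ i
      gather ⊤≰⊥ ℕ.zero    ρ = 0 , step (minimum ⊤) ⊤≰⊥ (end Eq.refl) , λ _ ()
      gather ⊤≰⊥ (ℕ.suc n) ρ with gather ⊤≰⊥ n ρ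
      ... | m , p , p∋ with insert p (ρ n) (minimum _)
      ...   | ℕ.zero  , end ⊥≈⊤ , _ , _ = contradiction (reflexive (Eq.sym ⊥≈⊤)) ⊤≰⊥
      ...   | ℕ.suc k , q , q∋ρn , p⊆q = k , q , λ i i<n+1 → q∋ i (ℕₚ.m<1+n⇒m<n∨m≡n i<n+1)
        where
        q∋ : ∀ i → i ℕ.< n ⊎ i ≡ n → q ∋ ρ i
        q∋ i (inj₁ i<n)    = p⊆q _ (p∋ i i<n)
        q∋ i (inj₂ ≡.refl) = q∋ρn

    -- The values of finitely many variables generate a finite subchain, so an
    -- identity that holds in the finite subchains holds in the chain.
    finitely-determined : ∀ s t →
      (∀ k → Embedding (Cᵈᵖ (2 + k)) A → Cᵈᵖ (2 + k) ⊨ s ≐ t) → A ⊨ s ≐ t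
    finitely-determined s t C⊨ ρ with em {⊤ ≤ ⊥}
    ... | yes ⊤≤⊥ = Eq.trans (≈⊥ _) (Eq.sym (≈⊥ _))
      where
      ≈⊥ : ∀ x → x ≈ ⊥
      ≈⊥ x = ≤⊥⇒≈⊥ (≤-trans (maximum x) ⊤≤⊥)
    ... | no  ⊤≰⊥ with gather ⊤≰⊥ (bound s ℕ.⊔ bound t) ρ
    ...   | k , p , p∋ = begin
      ⟦ A ⟧ s ρ                  ≈⟨ ⟦⟧-local A s (λ i i<s →
                                      ρ≈ i (ℕₚ.<-≤-trans i<s (ℕₚ.m≤m⊔n _ _))) ⟩
      ⟦ A ⟧ s (λ i → at p (σ i)) ≈⟨ ⊨-image h s t (C⊨ k h) σ ⟩
      ⟦ A ⟧ t (λ i → at p (σ i)) ≈⟨ ⟦⟧-local A t (λ i i<t →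
                                      ρ≈ i (ℕₚ.<-≤-trans i<t (ℕₚ.m≤n⊔m (bound s) _))) ⟨
      ⟦ A ⟧ t ρ                  ∎
      where
      open ≈-Reasoning (setoid A)
      h : Embedding (Cᵈᵖ (2 + k)) A
      h = spine⇒embedding (ascent⇒spine p)
      n : ℕ
      n = bound s ℕ.⊔ bound t
      σ : ℕ → Fin (2 + k)
      σ i with i ℕₚ.<? n
      ... | yes i<n = proj₁ (p∋ i i<n)
      ... | no  _   = zero
      ρ≈ : ∀ i → i ℕ.< n → ρ i ≈ at p (σ i)
      ρ≈ i i<n with i ℕₚ.<? n
      ... | yes q   = proj₂ (p∋ i q)
      ... | no  i≮n = contradiction i<n i≮n

-- Omitting the second element embeds a finite chain in the next one.
Cᵈᵖ-embedding : ∀ k → Embedding (Cᵈᵖ (2 + k)) (Cᵈᵖ (3 + k))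
Cᵈᵖ-embedding k = spine⇒embedding record
  { at         = at′
  ; increasing = λ i<j → ≤-intro (ℕₚ.<⇒≤ (at-< i<j)) , λ q → ℕₚ.<⇒≱ (at-< i<j) (≤-elim q)
  ; bottom     = ≡.refl
  ; top        = ≡.refl
  }
  where
  open FiniteChain (2 + k) using (isDStHChain; ⊓-≤; ≤-or->; ⊓-≥)
  open ChainLaws (Cᵈᵖ (3 + k)) isDStHChain using (_≤_; spine⇒embedding)
  at′ : Fin (2 + k) → Fin (3 + k)
  at′ = Fin.punchIn (suc zero)
  at-< : ∀ {i j} → i Fin.< j → at′ i Fin.< at′ j
  at-< {zero}  {suc j} _   = s≤s z≤n
  at-< {suc i} {suc j} i<j = s≤s i<j
  ≤-intro : ∀ {i j : Fin (3 + k)} → i Fin.≤ j → i ≤ j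
  ≤-intro {i} {j} i≤j = ≡.sym (⊓-≤ i j i≤j)
  ≤-elim : ∀ {i j : Fin (3 + k)} → i ≤ j → i Fin.≤ j
  ≤-elim {i} {j} i≤j with ≤-or-> i j
  ... | inj₁ p = p
  ... | inj₂ j<i = ℕₚ.≤-reflexive (≡.cong Fin.toℕ (≡.trans i≤j (⊓-≥ i j (ℕₚ.<⇒≤ j<i))))

-- Central elements

module JIDL₁Laws (A : Algebra) (A∈JIDL₁ : A ∈ᵛ JIDL₁) where

  A∈DQD : A ∈ᵛ DQD
  A∈DQD e a = A∈JIDL₁ e (dqd a)

  isHeyting : A ⊨ (var 0 ∧ var 1) ⇒ var 1 ≐ 𝟏
  isHeyting ρ = DQDLaws.prelinear⇒heyting A A∈DQD
    (λ x y → A∈JIDL₁ _ linear ⟨ x , y , y ⟩) (ρ 0) (ρ 1)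

  open HeytingLaws A A∈DQD isHeyting public

  linear-law : ∀ x y → (x ⇨ y) ⊔ (y ⇨ x) ≈ ⊤
  linear-law x y = A∈JIDL₁ _ linear ⟨ x , y , y ⟩

  private module ≈R = ≈-Reasoning (setoid A)

  xᵈ⊔xᵈᶜ≈⊤ : ∀ x → x ᵈ ⊔ x ᵈ ᶜ ≈ ⊤
  xᵈ⊔xᵈᶜ≈⊤ x = begin
    x ᵈ ⊔ (x ᵈ ⇨ ⊥)             ≈⟨ A∈JIDL₁ _ jid ⟨ x , x ᵈ , ⊥ ⟩ ⟩
    (x ᵈ ⊔ x ᵈ) ⇨ (x ᵈ ⊔ ⊥)     ≈⟨ ⇨-cong (⊔-idem _) (⊔-identityʳ _) ⟩
    x ᵈ ⇨ x ᵈ                   ≈⟨ ⇨-refl _ ⟩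
    ⊤                           ∎
    where open ≈R

  -- The central elements form a Boolean algebra in which x ᵈ is the complement.
  Central : Carrier → Set
  Central u = u ≈ u ᵈ ᶜ

  -- The largest central element below x.
  core : Carrier → Carrier
  core x = x ⊓ x ᵈ ᶜ

  -- Every central element is ⊥ or ⊤, stated for the cores of all elements.
  IsSimple : Set
  IsSimple = ∀ x → x ≈ ⊤ ⊎ core x ≈ ⊥

  core-central : ∀ x → Central (core x)
  core-central x = A∈JIDL₁ _ level₁ ⟨ x , x , x ⟩

  central-⊔ : ∀ {u} → Central u → u ⊔ u ᵈ ≈ ⊤
  central-⊔ {u} c = Eq.trans (⊔-comm u _) (Eq.trans (⊔-cong Eq.refl c) (xᵈ⊔xᵈᶜ≈⊤ u))

  central-⊓ : ∀ {u} → Central u → u ⊓ u ᵈ ≈ ⊥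
  central-⊓ {u} c = Eq.trans (⊓-comm u _) (Eq.trans (⊓-cong Eq.refl c) (x⊓xᶜ≈⊥ _))

  central-ᵈᵈ : ∀ {u} → Central u → u ᵈ ᵈ ≈ u
  central-ᵈᵈ {u} c = complement-unique {u ᵈ}
    (≤⊥⇒≈⊥ (≤-trans (⊓-monotonic ≤-refl (xᵈᵈ≤x u)) (reflexive uᵈ⊓u≈⊥)))
    (Eq.trans (Eq.sym (⊓-ᵈ u (u ᵈ))) (Eq.trans (ᵈ-cong (central-⊓ c)) ⊥ᵈ))
    uᵈ⊓u≈⊥
    (Eq.trans (⊔-comm _ u) (central-⊔ c))
    where
    uᵈ⊓u≈⊥ : u ᵈ ⊓ u ≈ ⊥
    uᵈ⊓u≈⊥ = Eq.trans (⊓-comm _ u) (central-⊓ c)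

  ᵈ-central : ∀ {u} → Central u → Central (u ᵈ)
  ᵈ-central {u} c = Eq.sym (Eq.trans (ᶜ-cong (central-ᵈᵈ c))
    (complement⇒ᶜ (central-⊓ c) (central-⊔ c)))

  ⊓-central : ∀ {u v} → Central u → Central v → Central (u ⊓ v)
  ⊓-central {u} {v} c d = begin
    u ⊓ v               ≈⟨ ⊓-cong c d ⟩
    u ᵈ ᶜ ⊓ v ᵈ ᶜ       ≈⟨ Heytingₚ.de-morgan₁ heytingAlgebra (u ᵈ) (v ᵈ) ⟨
    (u ᵈ ⊔ v ᵈ) ᶜ       ≈⟨ ᶜ-cong (⊓-ᵈ u v) ⟨
    (u ⊓ v) ᵈ ᶜ         ∎
    where open ≈R

  ⊤-central : Central ⊤
  ⊤-central = Eq.sym (Eq.trans (ᶜ-cong ⊤ᵈ) (⇨-refl ⊥))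

  -- Congruence modulo a descending sequence of central elements

  -- Equality modulo the principal filter of u.
  infix 4 _≈[_]_
  _≈[_]_ : Carrier → Carrier → Carrier → Set
  x ≈[ u ] y = u ⊓ x ≈ u ⊓ y

  ≈[]-weaken : ∀ {u w x y} → w ≤ u → x ≈[ u ] y → x ≈[ w ] y
  ≈[]-weaken {u} {w} {x} {y} w≤u p = begin
    w ⊓ x         ≈⟨ ⊓-cong w≤u Eq.refl ⟩
    (w ⊓ u) ⊓ x   ≈⟨ ⊓-assoc w u x ⟩
    w ⊓ u ⊓ x     ≈⟨ ⊓-cong Eq.refl p ⟩
    w ⊓ u ⊓ y     ≈⟨ ⊓-assoc w u y ⟨
    (w ⊓ u) ⊓ y   ≈⟨ ⊓-cong w≤u Eq.refl ⟨
    w ⊓ y         ∎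
    where open ≈R

  private
    -- Under a central element u, an operation depends only on the meets of its
    -- arguments with u.
    ⊓-local : ∀ u x y → u ⊓ (x ⊓ y) ≈ u ⊓ ((u ⊓ x) ⊓ (u ⊓ y))
    ⊓-local u x y = antisym
      (⊓-greatest (x⊓y≤x _ _) (⊓-greatest
        (⊓-monotonic ≤-refl (x⊓y≤x x y)) (⊓-monotonic ≤-refl (x⊓y≤y x y))))
      (⊓-monotonic ≤-refl (⊓-monotonic (x⊓y≤y u x) (x⊓y≤y u y)))

    ⊔-local : ∀ u x y → u ⊓ (x ⊔ y) ≈ u ⊓ ((u ⊓ x) ⊔ (u ⊓ y))
    ⊔-local u x y = antisym
      (⊓-greatest (x⊓y≤x _ _) (reflexive (⊓-distribˡ-⊔ u x y)))
      (⊓-monotonic ≤-refl (⊔-monotonic (x⊓y≤y u x) (x⊓y≤y u y)))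

    ᵈ-local : ∀ {u} → Central u → ∀ x → u ⊓ x ᵈ ≈ u ⊓ (u ⊓ x) ᵈ
    ᵈ-local {u} c x = Eq.sym (begin
      u ⊓ (u ⊓ x) ᵈ             ≈⟨ ⊓-cong Eq.refl (⊓-ᵈ u x) ⟩
      u ⊓ (u ᵈ ⊔ x ᵈ)           ≈⟨ ⊓-distribˡ-⊔ u _ _ ⟩
      (u ⊓ u ᵈ) ⊔ (u ⊓ x ᵈ)     ≈⟨ ⊔-cong (central-⊓ c) Eq.refl ⟩
      ⊥ ⊔ (u ⊓ x ᵈ)             ≈⟨ ⊔-identityˡ _ ⟩
      u ⊓ x ᵈ                   ∎)
      where open ≈R

    ≈[]-cong₂ : (_∙_ : Carrier → Carrier → Carrier) →
      (∀ {x y z w} → x ≈ y → z ≈ w → (x ∙ z) ≈ (y ∙ w)) →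
      (∀ u x y → u ⊓ (x ∙ y) ≈ u ⊓ ((u ⊓ x) ∙ (u ⊓ y))) →
      ∀ {u x y z w} → x ≈[ u ] y → z ≈[ u ] w → (x ∙ z) ≈[ u ] (y ∙ w)
    ≈[]-cong₂ _∙_ ∙-cong local {u} {x} {y} {z} {w} p q = begin
      u ⊓ (x ∙ z)                 ≈⟨ local u x z ⟩
      u ⊓ ((u ⊓ x) ∙ (u ⊓ z))     ≈⟨ ⊓-cong Eq.refl (∙-cong p q) ⟩
      u ⊓ ((u ⊓ y) ∙ (u ⊓ w))     ≈⟨ local u y w ⟨
      u ⊓ (y ∙ w)                 ∎
      where open ≈R

    ≈[]-ᵈ : ∀ {u x y} → Central u → x ≈[ u ] y → (x ᵈ) ≈[ u ] (y ᵈ)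
    ≈[]-ᵈ c p = Eq.trans (ᵈ-local c _)
      (Eq.trans (⊓-cong Eq.refl (ᵈ-cong p)) (Eq.sym (ᵈ-local c _)))

  -- The quotient by the filter generated by the terms of the sequence v; it has
  -- the same elements and operations as A.
  module Quotient (v : ℕ → Carrier) (v-central : ∀ n → Central (v n))
                  (v-descending : ∀ {m n} → m ℕ.≤ n → v n ≤ v m) where

    private
      _~_ : Carrier → Carrier → Set
      x ~ y = ∃ λ n → x ≈[ v n ] y

      common : ∀ {x y z w x′ y′} →
        (∀ n → x ≈[ v n ] y → z ≈[ v n ] w → x′ ≈[ v n ] y′) → x ~ y → z ~ w → x′ ~ y′
      common f (m , p) (n , q) = m ℕ.⊔ n , f _
        (≈[]-weaken (v-descending (ℕₚ.m≤m⊔n m n)) p)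
        (≈[]-weaken (v-descending (ℕₚ.m≤n⊔m m n)) q)

    quotient : Algebra
    quotient = record
      { Carrier = Carrier
      ; _≈_     = _~_
      ; isEquivalence = record
        { refl  = 0 , Eq.refl
        ; sym   = λ (n , p) → n , Eq.sym p
        ; trans = common (λ _ p q → Eq.trans p q)
        }
      ; _∨_    = _⊔_
      ; _∧_    = _⊓_
      ; _⇒_    = _⇨_
      ; _′     = _ᵈ
      ; 𝟎      = ⊥
      ; 𝟏      = ⊤
      ; ∨-cong = common λ _ → ≈[]-cong₂ _⊔_ ⊔-cong ⊔-local
      ; ∧-cong = common λ _ → ≈[]-cong₂ _⊓_ ⊓-cong ⊓-local
      ; ⇒-cong = common λ _ → ≈[]-cong₂ _⇨_ ⇨-cong ⊓-⇨-⊓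
      ; ′-cong = λ (n , p) → n , ≈[]-ᵈ (v-central n) p
      }

    ⟦⟧-quotient : ∀ t ρ → ⟦ quotient ⟧ t ρ ≡ ⟦ A ⟧ t ρ
    ⟦⟧-quotient (var i) ρ = ≡.refl
    ⟦⟧-quotient (s ∨ t) ρ = ≡.cong₂ _⊔_ (⟦⟧-quotient s ρ) (⟦⟧-quotient t ρ)
    ⟦⟧-quotient (s ∧ t) ρ = ≡.cong₂ _⊓_ (⟦⟧-quotient s ρ) (⟦⟧-quotient t ρ)
    ⟦⟧-quotient (s ⇒ t) ρ = ≡.cong₂ _⇨_ (⟦⟧-quotient s ρ) (⟦⟧-quotient t ρ)
    ⟦⟧-quotient (t ′)   ρ = ≡.cong _ᵈ (⟦⟧-quotient t ρ)
    ⟦⟧-quotient 𝟎       ρ = ≡.refl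
    ⟦⟧-quotient 𝟏       ρ = ≡.refl

    ⊨-quotient : ∀ e → A ⊨ e → quotient ⊨ e
    ⊨-quotient (s ≐ t) A⊨e ρ rewrite ⟦⟧-quotient s ρ | ⟦⟧-quotient t ρ =
      0 , ⊓-cong Eq.refl (A⊨e ρ)

  -- A central element under which s and t remain distinct.
  Separating : (s t u : Carrier) → Set
  Separating s t u = Central u × ¬ s ≈[ u ] t

  -- Under u, the core of x is either ⊤ or ⊥.
  Decides : (u x : Carrier) → Set
  Decides u x = u ≤ core x ⊎ u ≤ (core x) ᵈ

  decides-antitone : ∀ {u w x} → w ≤ u → Decides u x → Decides w x
  decides-antitone w≤u = Sum.map (≤-trans w≤u) (≤-trans w≤u)

  -- For two distinct elements s and t of a countable algebra, a descending
  -- sequence of central elements that separate s and t and decide all elements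
  -- of the algebra: a base of an ultrafilter of the Boolean algebra of central
  -- elements.
  module Ultrafilter (em : ExcludedMiddle 0ℓ)
    (stage : ℕ → List Carrier) (exhaustive : ∀ x → ∃ λ n → x ∈ stage n)
    (s t : Carrier) (s≉t : ¬ s ≈ t) where

    private
      State : Set
      State = ∃ (Separating s t)

      -- Since u is the join of its meets with core x and its complement, one of
      -- the two meets still separates s and t.
      glue : ∀ u x → s ≈[ u ⊓ core x ] t → s ≈[ u ⊓ (core x) ᵈ ] t → s ≈[ u ] t
      glue u x p q = begin
        u ⊓ s                                  ≈⟨ halves s ⟩
        ((u ⊓ c) ⊓ s) ⊔ ((u ⊓ c ᵈ) ⊓ s)        ≈⟨ ⊔-cong p q ⟩
        ((u ⊓ c) ⊓ t) ⊔ ((u ⊓ c ᵈ) ⊓ t)        ≈⟨ halves t ⟨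
        u ⊓ t                                  ∎
        where
        open ≈R
        c : Carrier
        c = core x
        swap : ∀ a b d → (a ⊓ b) ⊓ d ≈ (a ⊓ d) ⊓ b
        swap a b d = Eq.trans (⊓-assoc a b d)
          (Eq.trans (⊓-cong Eq.refl (⊓-comm b d)) (Eq.sym (⊓-assoc a d b)))
        halves : ∀ y → u ⊓ y ≈ ((u ⊓ c) ⊓ y) ⊔ ((u ⊓ c ᵈ) ⊓ y)
        halves y = begin
          u ⊓ y                                 ≈⟨ ⊓-identityʳ _ ⟨
          (u ⊓ y) ⊓ ⊤                           ≈⟨ ⊓-cong Eq.refl (central-⊔ (core-central x)) ⟨
          (u ⊓ y) ⊓ (c ⊔ c ᵈ)                   ≈⟨ ⊓-distribˡ-⊔ _ _ _ ⟩
          ((u ⊓ y) ⊓ c) ⊔ ((u ⊓ y) ⊓ c ᵈ)       ≈⟨ ⊔-cong (swap u y c) (swap u y (c ᵈ)) ⟩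
          ((u ⊓ c) ⊓ y) ⊔ ((u ⊓ c ᵈ) ⊓ y)       ∎

      split : ∀ x ((u , _) : State) → Σ State λ (w , _) → w ≤ u × Decides w x
      split x (u , u-central , u-separates) with em {s ≈[ u ⊓ core x ] t}
      ... | no  ≉ = (u ⊓ core x , ⊓-central u-central (core-central x) , ≉)
                  , x⊓y≤x _ _ , inj₁ (x⊓y≤y _ _)
      ... | yes p = (u ⊓ (core x) ᵈ , ⊓-central u-central (ᵈ-central (core-central x))
                    , λ q → u-separates (glue u x p q))
                  , x⊓y≤x _ _ , inj₂ (x⊓y≤y _ _)

      splitAll : ∀ xs ((u , _) : State) →
                 Σ State λ (w , _) → w ≤ u × (∀ {x} → x ∈ xs → Decides w x)
      splitAll []       u = u , ≤-refl , λ ()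
      splitAll (x ∷ xs) u with split x u
      ... | u₁ , u₁≤u , d₁ with splitAll xs u₁
      ...   | u₂ , u₂≤u₁ , d₂ = u₂ , ≤-trans u₂≤u₁ u₁≤u , λ where
                (here ≡.refl) → decides-antitone u₂≤u₁ d₁
                (there x∈xs)  → d₂ x∈xs

      state : ℕ → State
      state 0         = ⊤ , ⊤-central , λ p → s≉t
        (Eq.trans (Eq.sym (⊓-identityˡ s)) (Eq.trans p (⊓-identityˡ t)))
      state (ℕ.suc n) = proj₁ (splitAll (stage n) (state n))

    base : ℕ → Carrier
    base n = proj₁ (state n)

    base-central : ∀ n → Central (base n)
    base-central n = proj₁ (proj₂ (state n))

    base-separates : ∀ n → ¬ s ≈[ base n ] t
    base-separates n = proj₂ (proj₂ (state n))

    base-descending : ∀ {m n} → m ℕ.≤ n → base n ≤ base m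
    base-descending m≤n = go (ℕₚ.≤⇒≤′ m≤n)
      where
      go : ∀ {m n} → m ℕ.≤′ n → base n ≤ base m
      go (ℕ.≤′-reflexive ≡.refl) = ≤-refl
      go (ℕ.≤′-step {n} m≤′n)    =
        ≤-trans (proj₁ (proj₂ (splitAll (stage n) (state n)))) (go m≤′n)

    base-decides : ∀ x → ∃ λ n → Decides (base n) x
    base-decides x with exhaustive x
    ... | n , x∈ = ℕ.suc n , proj₂ (proj₂ (splitAll (stage n) (state n))) x∈

    open Quotient base base-central base-descending public

    quotient-separates : ¬ Algebra._≈_ quotient s t
    quotient-separates (n , p) = base-separates n p

    quotient-simple : ∀ x → Algebra._≈_ quotient x ⊤ ⊎ Algebra._≈_ quotient (core x) ⊥
    quotient-simple x with base-decides x
    ... | n , inj₁ u≤core = inj₁ (n , Eq.trans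
            (x≤y⇒x⊓y≈x (≤-trans u≤core (x⊓y≤x _ _))) (Eq.sym (⊓-identityʳ _)))
    ... | n , inj₂ u≤coreᵈ = inj₂ (n , Eq.trans
            (≤⊥⇒≈⊥ (≤-trans (⊓-greatest (x⊓y≤y _ _) (≤-trans (x⊓y≤x _ _) u≤coreᵈ))
                            (reflexive (central-⊓ (core-central x)))))
            (Eq.sym (⊓-zeroʳ _)))

-- Simple algebras

module SimpleLaws (A : Algebra) (A∈JIDL₁ : A ∈ᵛ JIDL₁)
  (simple : JIDL₁Laws.IsSimple A A∈JIDL₁) where

  open JIDL₁Laws A A∈JIDL₁

  private
    -- As x ᵈ and x ᵈ ᶜ are complements, core x ≈ ⊥ means x ≤ x ᵈ.
    abstract
      ⊤-or-≤ᵈ : ∀ x → x ≈ ⊤ ⊎ x ≤ x ᵈ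
      ⊤-or-≤ᵈ x = Sum.map (λ p → p) (λ core≈⊥ → complement-≤
        (Eq.trans (⊓-comm _ x) core≈⊥) (Eq.trans (⊔-comm _ _) (xᵈ⊔xᵈᶜ≈⊤ x))) (simple x)

  trichotomy : ∀ x → x ≈ ⊤ ⊎ x ᵈ ≈ ⊤ ⊎ x ≈ x ᵈ
  trichotomy x with ⊤-or-≤ᵈ x | ⊤-or-≤ᵈ (x ᵈ)
  ... | inj₁ x≈⊤  | _           = inj₁ x≈⊤
  ... | inj₂ _    | inj₁ xᵈ≈⊤   = inj₂ (inj₁ xᵈ≈⊤)
  ... | inj₂ x≤xᵈ | inj₂ xᵈ≤xᵈᵈ = inj₂ (inj₂ (antisym x≤xᵈ (≤-trans xᵈ≤xᵈᵈ (xᵈᵈ≤x x))))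

  -- Without fixed points of ᵈ, the algebra is a chain: one of the two joinands
  -- of (x ⇨ y) ⊔ (y ⇨ x) must be ⊤.
  module NoFixpoint (no-fixpoint : ∀ x → ¬ x ≈ x ᵈ) where

    private
      ⊤-or-ᵈ≈⊤ : ∀ x → x ≈ ⊤ ⊎ x ᵈ ≈ ⊤
      ⊤-or-ᵈ≈⊤ x with trichotomy x
      ... | inj₁ p        = inj₁ p
      ... | inj₂ (inj₁ p) = inj₂ p
      ... | inj₂ (inj₂ p) = contradiction p (no-fixpoint x)

      ⊔-prime : ∀ x y → x ⊔ y ≈ ⊤ → x ≈ ⊤ ⊎ y ≈ ⊤
      ⊔-prime x y p with ⊤-or-ᵈ≈⊤ x
      ... | inj₁ q = inj₁ q
      ... | inj₂ q = inj₂ (⊤≤⇒≈⊤ (≤-trans (reflexive (Eq.sym yᵈᵈ≈⊤)) (xᵈᵈ≤x y)))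
        where
        open ≈-Reasoning (setoid A)
        yᵈᵈ≈⊤ : y ᵈ ᵈ ≈ ⊤
        yᵈᵈ≈⊤ = begin
          y ᵈ ᵈ             ≈⟨ ⊔-identityˡ _ ⟨
          ⊥ ⊔ y ᵈ ᵈ         ≈⟨ ⊔-cong (Eq.trans (ᵈ-cong q) ⊤ᵈ) Eq.refl ⟨
          x ᵈ ᵈ ⊔ y ᵈ ᵈ     ≈⟨ ⊔-ᵈᵈ x y ⟨
          (x ⊔ y) ᵈ ᵈ       ≈⟨ ᵈ-cong (ᵈ-cong p) ⟩
          ⊤ ᵈ ᵈ             ≈⟨ ⊤ᵈᵈ ⟩
          ⊤                 ∎

      ⇨≈⊤⇒≤ : ∀ {x y} → x ⇨ y ≈ ⊤ → x ≤ y
      ⇨≈⊤⇒≤ {x} {y} p = ≤-trans (⊓-greatest (maximum x) ≤-refl)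
        (transpose-⊓ (reflexive (Eq.sym p)))

      dualStone : ∀ x → x ᵈ ⊓ x ᵈ ᵈ ≈ ⊥
      dualStone x with ⊤-or-ᵈ≈⊤ x
      ... | inj₁ p = Eq.trans (⊓-cong (Eq.trans (ᵈ-cong p) ⊤ᵈ) Eq.refl) (⊓-zeroˡ _)
      ... | inj₂ p = Eq.trans (⊓-cong Eq.refl (Eq.trans (ᵈ-cong p) ⊤ᵈ)) (⊓-zeroʳ _)

    isDStHChain : IsDStHChain A
    isDStHChain = record
      { isDQD       = A∈DQD
      ; isDualStone = λ ρ → dualStone (ρ 0)
      ; isHeyting   = isHeyting
      ; isChain     = λ x y → Sum.map (λ p → Eq.sym (⇨≈⊤⇒≤ p)) (λ p → Eq.sym (⇨≈⊤⇒≤ p))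
                        (⊔-prime _ _ (linear-law x y))
      }

  -- With a fixed point c of ᵈ, the algebra is {⊥, c, c ᶜ, ⊤}.
  module Fixpoint (⊥≉⊤ : ¬ ⊥ ≈ ⊤) (c : Carrier) (c≈cᵈ : c ≈ c ᵈ) where

    private
      open module ≈R = ≈-Reasoning (setoid A)

      d : Carrier
      d = c ᶜ

      fixed-ᵈᵈ : ∀ {x} → x ≈ x ᵈ → x ᵈ ᵈ ≈ x
      fixed-ᵈᵈ p = Eq.trans (ᵈ-cong (Eq.sym p)) (Eq.sym p)

      fixed≉⊤ : ∀ {x} → x ≈ x ᵈ → ¬ x ≈ ⊤
      fixed≉⊤ p x≈⊤ = ⊥≉⊤ (Eq.trans (Eq.sym ⊤ᵈ)
        (Eq.trans (ᵈ-cong (Eq.sym x≈⊤)) (Eq.trans (Eq.sym p) x≈⊤)))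

      fixed≉⊥ : ∀ {x} → x ≈ x ᵈ → ¬ x ≈ ⊥
      fixed≉⊥ p x≈⊥ = ⊥≉⊤ (Eq.trans (Eq.sym x≈⊥) (Eq.trans p (Eq.trans (ᵈ-cong x≈⊥) ⊥ᵈ)))

      c⊓d : c ⊓ d ≈ ⊥
      c⊓d = x⊓xᶜ≈⊥ c

      c⊔d : c ⊔ d ≈ ⊤
      c⊔d = Eq.trans (⊔-cong c≈cᵈ (ᶜ-cong c≈cᵈ)) (xᵈ⊔xᵈᶜ≈⊤ c)

      d⊓c : d ⊓ c ≈ ⊥
      d⊓c = Eq.trans (⊓-comm d c) c⊓d

      d⊔c : d ⊔ c ≈ ⊤
      d⊔c = Eq.trans (⊔-comm d c) c⊔d

      d≈dᵈ : d ≈ d ᵈ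
      d≈dᵈ with trichotomy d
      ... | inj₁ d≈⊤ = contradiction
              (Eq.trans (Eq.sym (⊓-identityʳ c)) (Eq.trans (⊓-cong Eq.refl (Eq.sym d≈⊤)) c⊓d))
              (fixed≉⊥ c≈cᵈ)
      ... | inj₂ (inj₂ p) = p
      ... | inj₂ (inj₁ dᵈ≈⊤) = contradiction (begin
              c                 ≈⟨ fixed-ᵈᵈ c≈cᵈ ⟨
              c ᵈ ᵈ             ≈⟨ ⊔-identityʳ _ ⟨
              c ᵈ ᵈ ⊔ ⊥         ≈⟨ ⊔-cong Eq.refl (Eq.trans (ᵈ-cong dᵈ≈⊤) ⊤ᵈ) ⟨
              c ᵈ ᵈ ⊔ d ᵈ ᵈ     ≈⟨ ⊔-ᵈᵈ c d ⟨
              (c ⊔ d) ᵈ ᵈ       ≈⟨ ᵈ-cong (ᵈ-cong c⊔d) ⟩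
              ⊤ ᵈ ᵈ             ≈⟨ ⊤ᵈᵈ ⟩
              ⊤                 ∎) (fixed≉⊤ c≈cᵈ)

      -- The trichotomy for x ⊔ y leaves only x ⊔ y ≈ (x ⊔ y) ᵈ ≤ y ᵈ ≈ y, because
      -- (x ⊔ y) ᵈ ᵈ ≈ y.
      ᵈ≈⊤⇒≤fixed : ∀ {x y} → x ᵈ ≈ ⊤ → y ≈ y ᵈ → x ≤ y
      ᵈ≈⊤⇒≤fixed {x} {y} xᵈ≈⊤ y≈yᵈ with trichotomy (x ⊔ y)
      ... | inj₁ p = contradiction
              (Eq.trans (Eq.sym x⊔yᵈᵈ) (Eq.trans (ᵈ-cong (ᵈ-cong p)) ⊤ᵈᵈ)) (fixed≉⊤ y≈yᵈ)
        where
        x⊔yᵈᵈ : (x ⊔ y) ᵈ ᵈ ≈ y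
        x⊔yᵈᵈ = Eq.trans (⊔-ᵈᵈ x y) (Eq.trans
          (⊔-cong (Eq.trans (ᵈ-cong xᵈ≈⊤) ⊤ᵈ) (fixed-ᵈᵈ y≈yᵈ)) (⊔-identityˡ y))
      ... | inj₂ (inj₁ p) = contradiction
              (≤⊥⇒≈⊥ (≤-trans (reflexive (Eq.sym (fixed-ᵈᵈ y≈yᵈ)))
                (≤-trans (ᵈ-antitone (ᵈ-antitone (y≤x⊔y x y)))
                  (reflexive (Eq.trans (ᵈ-cong p) ⊤ᵈ))))) (fixed≉⊥ y≈yᵈ)
      ... | inj₂ (inj₂ p) = ≤-trans (x≤x⊔y x y) (≤-trans (reflexive p)
              (≤-trans (ᵈ-antitone (y≤x⊔y x y)) (reflexive (Eq.sym y≈yᵈ))))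

      ᵈ≈⊤⇒≈⊥ : ∀ {x} → x ᵈ ≈ ⊤ → x ≈ ⊥
      ᵈ≈⊤⇒≈⊥ p = ≤⊥⇒≈⊥ (≤-trans
        (⊓-greatest (ᵈ≈⊤⇒≤fixed p c≈cᵈ) (ᵈ≈⊤⇒≤fixed p d≈dᵈ)) (reflexive c⊓d))

      -- A fixed point is c or a complement of c, according to whether its join with
      -- c is a fixed point or ⊤.
      fixed⇒c-or-d : ∀ x → x ≈ x ᵈ → x ≈ c ⊎ x ≈ d
      fixed⇒c-or-d x x≈xᵈ with trichotomy (x ⊔ c)
      ... | inj₁ p = inj₂ (complement-unique c⊓x≈⊥ (Eq.trans (⊔-comm c x) p) c⊓d c⊔d)
        where
        c⊓x≈⊥ : c ⊓ x ≈ ⊥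
        c⊓x≈⊥ = ᵈ≈⊤⇒≈⊥ (begin
          (c ⊓ x) ᵈ     ≈⟨ ⊓-ᵈ c x ⟩
          c ᵈ ⊔ x ᵈ     ≈⟨ ⊔-cong c≈cᵈ x≈xᵈ ⟨
          c ⊔ x         ≈⟨ ⊔-comm c x ⟩
          x ⊔ c         ≈⟨ p ⟩
          ⊤             ∎)
      ... | inj₂ (inj₁ p) = contradiction
              (≤⊥⇒≈⊥ (≤-trans (y≤x⊔y x c) (reflexive (ᵈ≈⊤⇒≈⊥ p)))) (fixed≉⊥ c≈cᵈ)
      ... | inj₂ (inj₂ p) = inj₁ (antisym (≤-trans (x≤x⊔y x c) (≤-trans (reflexive p)
                (≤-trans (ᵈ-antitone (y≤x⊔y x c)) (reflexive (Eq.sym c≈cᵈ)))))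
              (≤-trans (y≤x⊔y x c) (≤-trans (reflexive p)
                (≤-trans (ᵈ-antitone (x≤x⊔y x c)) (reflexive (Eq.sym x≈xᵈ))))))

      point : Bool × Bool → Carrier
      point (false , false) = ⊥
      point (true  , false) = c
      point (false , true)  = d
      point (true  , true)  = ⊤

      module D = Algebra D₂

      ⊔-homo : ∀ p q → point (p D.∨ q) ≈ point p ⊔ point q
      ⊔-homo (false , false) q               = Eq.sym (⊔-identityˡ (point q))
      ⊔-homo (true  , true)  q               = Eq.sym (⊔-zeroˡ (point q))
      ⊔-homo (true  , false) (false , false) = Eq.sym (⊔-identityʳ c)
      ⊔-homo (true  , false) (true  , false) = Eq.sym (⊔-idem c)
      ⊔-homo (true  , false) (false , true)  = Eq.sym c⊔d
      ⊔-homo (true  , false) (true  , true)  = Eq.sym (⊔-zeroʳ c)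
      ⊔-homo (false , true)  (false , false) = Eq.sym (⊔-identityʳ d)
      ⊔-homo (false , true)  (true  , false) = Eq.sym d⊔c
      ⊔-homo (false , true)  (false , true)  = Eq.sym (⊔-idem d)
      ⊔-homo (false , true)  (true  , true)  = Eq.sym (⊔-zeroʳ d)

      ⊓-homo : ∀ p q → point (p D.∧ q) ≈ point p ⊓ point q
      ⊓-homo (false , false) q               = Eq.sym (⊓-zeroˡ (point q))
      ⊓-homo (true  , true)  q               = Eq.sym (⊓-identityˡ (point q))
      ⊓-homo (true  , false) (false , false) = Eq.sym (⊓-zeroʳ c)
      ⊓-homo (true  , false) (true  , false) = Eq.sym (⊓-idem c)
      ⊓-homo (true  , false) (false , true)  = Eq.sym c⊓d
      ⊓-homo (true  , false) (true  , true)  = Eq.sym (⊓-identityʳ c)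
      ⊓-homo (false , true)  (false , false) = Eq.sym (⊓-zeroʳ d)
      ⊓-homo (false , true)  (true  , false) = Eq.sym d⊓c
      ⊓-homo (false , true)  (false , true)  = Eq.sym (⊓-idem d)
      ⊓-homo (false , true)  (true  , true)  = Eq.sym (⊓-identityʳ d)

      -- An implication between two complementary elements is its conclusion.
      complement-⇨ : ∀ {x y} → x ⊓ y ≈ ⊥ → x ⊔ y ≈ ⊤ → x ⇨ y ≈ y
      complement-⇨ {x} {y} p q = antisym
        (complement-≤ (≤⊥⇒≈⊥ (≤-trans (⊓-greatest (x⊓y≤x _ _)
          (≤-trans (reflexive (⊓-⇨ x y)) (x⊓y≤y _ _))) (reflexive p))) q)
        y≤x⇨y

      ⇨-homo : ∀ p q → point (p D.⇒ q) ≈ (point p ⇨ point q)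
      ⇨-homo (false , false) q               = Eq.sym (⊥-⇨ (point q))
      ⇨-homo (true  , true)  q               = Eq.sym (⊤-⇨ (point q))
      ⇨-homo (true  , false) (false , false) = Eq.refl
      ⇨-homo (true  , false) (true  , false) = Eq.sym (⇨-refl c)
      ⇨-homo (true  , false) (false , true)  = Eq.sym (complement-⇨ c⊓d c⊔d)
      ⇨-homo (true  , false) (true  , true)  = Eq.sym (≤⇒⇨≈⊤ (maximum c))
      ⇨-homo (false , true)  (false , false) = Eq.sym (complement⇒ᶜ d⊓c d⊔c)
      ⇨-homo (false , true)  (true  , false) = Eq.sym (complement-⇨ d⊓c d⊔c)
      ⇨-homo (false , true)  (false , true)  = Eq.sym (⇨-refl d)
      ⇨-homo (false , true)  (true  , true)  = Eq.sym (≤⇒⇨≈⊤ (maximum d))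

      ᵈ-homo : ∀ p → point (p D.′) ≈ point p ᵈ
      ᵈ-homo (false , false) = Eq.sym ⊥ᵈ
      ᵈ-homo (true  , false) = c≈cᵈ
      ᵈ-homo (false , true)  = d≈dᵈ
      ᵈ-homo (true  , true)  = Eq.sym ⊤ᵈ

      point≈⊤ : ∀ p → point p ≈ ⊤ → p ≡ (true , true)
      point≈⊤ (false , false) q = contradiction q ⊥≉⊤
      point≈⊤ (true  , false) q = contradiction q (fixed≉⊤ c≈cᵈ)
      point≈⊤ (false , true)  q = contradiction q (fixed≉⊤ d≈dᵈ)
      point≈⊤ (true  , true)  q = ≡.refl

      ⇒-antisym : ∀ p q → (p D.⇒ q) ≡ (true , true) → (q D.⇒ p) ≡ (true , true) → p ≡ q
      ⇒-antisym (false , false) (false , false) _  _  = ≡.refl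
      ⇒-antisym (false , true)  (false , true)  _  _  = ≡.refl
      ⇒-antisym (true  , false) (true  , false) _  _  = ≡.refl
      ⇒-antisym (true  , true)  (true  , true)  _  _  = ≡.refl
      ⇒-antisym (false , false) (false , true)  _  ()
      ⇒-antisym (false , false) (true  , false) _  ()
      ⇒-antisym (false , false) (true  , true)  _  ()
      ⇒-antisym (false , true)  (false , false) () _
      ⇒-antisym (false , true)  (true  , false) () _
      ⇒-antisym (false , true)  (true  , true)  _  ()
      ⇒-antisym (true  , false) (false , false) () _
      ⇒-antisym (true  , false) (false , true)  () _
      ⇒-antisym (true  , false) (true  , true)  _  ()
      ⇒-antisym (true  , true)  (false , false) () _
      ⇒-antisym (true  , true)  (false , true)  () _
      ⇒-antisym (true  , true)  (true  , false) () _

      point-injective : ∀ {p q} → point p ≈ point q → p ≡ q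
      point-injective {p} {q} e = ⇒-antisym p q
        (point≈⊤ _ (Eq.trans (⇨-homo p q) (≤⇒⇨≈⊤ (reflexive e))))
        (point≈⊤ _ (Eq.trans (⇨-homo q p) (≤⇒⇨≈⊤ (reflexive (Eq.sym e)))))

    D₂-embedding : Embedding D₂ A
    D₂-embedding = record
      { to        = point
      ; cong      = λ p → Eq.reflexive (≡.cong point p)
      ; injective = point-injective
      ; ∨-homo    = ⊔-homo
      ; ∧-homo    = ⊓-homo
      ; ⇒-homo    = ⇨-homo
      ; ′-homo    = ᵈ-homo
      ; 𝟎-homo    = Eq.refl
      ; 𝟏-homo    = Eq.refl
      }

    D₂-embedding-surjective : ∀ x → ∃ λ p → x ≈ Embedding.to D₂-embedding p
    D₂-embedding-surjective x with trichotomy x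
    ... | inj₁ p        = (true , true) , p
    ... | inj₂ (inj₁ p) = (false , false) , ᵈ≈⊤⇒≈⊥ p
    ... | inj₂ (inj₂ p) with fixed⇒c-or-d x p
    ...   | inj₁ q = (true , false) , q
    ...   | inj₂ q = (false , true) , q

-- The generators of a variety

-- An increasing sequence of finite lists that exhausts all terms.
terms : ℕ → List Term
terms 0         = []
terms (ℕ.suc n) = terms n ++ var n ∷ 𝟎 ∷ 𝟏 ∷ map _′ (terms n) ++
  (binary _∨_ ++ binary _∧_ ++ binary _⇒_)
  where
  binary : (Term → Term → Term) → List Term
  binary _∙_ = cartesianProductWith _∙_ (terms n) (terms n)

terms-mono : ∀ {m n t} → m ℕ.≤ n → t ∈ terms m → t ∈ terms n
terms-mono m≤n = go (ℕₚ.≤⇒≤′ m≤n)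
  where
  go : ∀ {m n t} → m ℕ.≤′ n → t ∈ terms m → t ∈ terms n
  go (ℕ.≤′-reflexive ≡.refl) t∈ = t∈
  go (ℕ.≤′-step m≤′n)        t∈ = ∈-++⁺ˡ (go m≤′n t∈)

terms-exhaustive : ∀ t → ∃ λ n → t ∈ terms n
terms-exhaustive (var i) = ℕ.suc i , ∈-++⁺ʳ (terms i) (here ≡.refl)
terms-exhaustive 𝟎       = 1 , there (here ≡.refl)
terms-exhaustive 𝟏       = 1 , there (there (here ≡.refl))
terms-exhaustive (t ′)   with terms-exhaustive t
... | n , t∈ = ℕ.suc n , ∈-++⁺ʳ (terms n) (there (there (there (∈-++⁺ˡ (∈-map⁺ _′ t∈)))))
terms-exhaustive (s ∨ t) with terms-exhaustive s | terms-exhaustive t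
... | m , s∈ | n , t∈ = ℕ.suc k , ∈-++⁺ʳ (terms k) (there (there (there (∈-++⁺ʳ (map _′ (terms k))
      (∈-++⁺ˡ (∈-cartesianProductWith⁺ _∨_
        (terms-mono (ℕₚ.m≤m⊔n m n) s∈) (terms-mono (ℕₚ.m≤n⊔m m n) t∈)))))))
  where
  k : ℕ
  k = m ℕ.⊔ n
terms-exhaustive (s ∧ t) with terms-exhaustive s | terms-exhaustive t
... | m , s∈ | n , t∈ = ℕ.suc k , ∈-++⁺ʳ (terms k) (there (there (there (∈-++⁺ʳ (map _′ (terms k))
      (∈-++⁺ʳ (cartesianProductWith _∨_ (terms k) (terms k)) (∈-++⁺ˡ (∈-cartesianProductWith⁺ _∧_
        (terms-mono (ℕₚ.m≤m⊔n m n) s∈) (terms-mono (ℕₚ.m≤n⊔m m n) t∈))))))))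
  where
  k : ℕ
  k = m ℕ.⊔ n
terms-exhaustive (s ⇒ t) with terms-exhaustive s | terms-exhaustive t
... | m , s∈ | n , t∈ = ℕ.suc k , ∈-++⁺ʳ (terms k) (there (there (there (∈-++⁺ʳ (map _′ (terms k))
      (∈-++⁺ʳ (cartesianProductWith _∨_ (terms k) (terms k))
        (∈-++⁺ʳ (cartesianProductWith _∧_ (terms k) (terms k)) (∈-cartesianProductWith⁺ _⇒_
          (terms-mono (ℕₚ.m≤m⊔n m n) s∈) (terms-mono (ℕₚ.m≤n⊔m m n) t∈))))))))
  where
  k : ℕ
  k = m ℕ.⊔ n

-- The subalgebra of A generated by the values of ρ, presented as a quotient of
-- the term algebra; it is countable.
generated : (A : Algebra) → (ℕ → Algebra.Carrier A) → Algebra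
generated A ρ = record
  { Carrier = Term
  ; _≈_     = λ s t → ⟦ A ⟧ s ρ A.≈ ⟦ A ⟧ t ρ
  ; isEquivalence = record
    { refl = A.isEquivalence.refl ; sym = A.isEquivalence.sym ; trans = A.isEquivalence.trans }
  ; _∨_ = _∨_ ; _∧_ = _∧_ ; _⇒_ = _⇒_ ; _′ = _′ ; 𝟎 = 𝟎 ; 𝟏 = 𝟏
  ; ∨-cong = A.∨-cong ; ∧-cong = A.∧-cong ; ⇒-cong = A.⇒-cong ; ′-cong = A.′-cong
  }
  where
  module A where
    open Algebra A public
    module isEquivalence = IsEquivalence isEquivalence

⟦⟧-generated : ∀ A ρ t → ⟦ generated A ρ ⟧ t var ≡ t
⟦⟧-generated A ρ (var i) = ≡.refl
⟦⟧-generated A ρ (s ∨ t) = ≡.cong₂ _∨_ (⟦⟧-generated A ρ s) (⟦⟧-generated A ρ t)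
⟦⟧-generated A ρ (s ∧ t) = ≡.cong₂ _∧_ (⟦⟧-generated A ρ s) (⟦⟧-generated A ρ t)
⟦⟧-generated A ρ (s ⇒ t) = ≡.cong₂ _⇒_ (⟦⟧-generated A ρ s) (⟦⟧-generated A ρ t)
⟦⟧-generated A ρ (t ′)   = ≡.cong _′ (⟦⟧-generated A ρ t)
⟦⟧-generated A ρ 𝟎       = ≡.refl
⟦⟧-generated A ρ 𝟏       = ≡.refl

generated-embedding : ∀ A ρ → Embedding (generated A ρ) A
generated-embedding A ρ = record
  { to        = λ t → ⟦ A ⟧ t ρ
  ; cong      = λ p → p
  ; injective = λ p → p
  ; ∨-homo    = λ _ _ → refl
  ; ∧-homo    = λ _ _ → refl
  ; ⇒-homo    = λ _ _ → refl
  ; ′-homo    = λ _ → refl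
  ; 𝟎-homo    = refl
  ; 𝟏-homo    = refl
  }
  where open IsEquivalence (Algebra.isEquivalence A)

-- B belongs to the variety generated by A.
Inherits : Algebra → Algebra → Set
Inherits A B = ∀ e → A ⊨ e → B ⊨ e

lower-em : ExcludedMiddle (lsuc 0ℓ) → ExcludedMiddle 0ℓ
lower-em em {P} = map′ lower lift (em {Lift (lsuc 0ℓ) P})

module _ (em : ExcludedMiddle 0ℓ) where

  -- A simple algebra is a dually Stone Heyting chain, a copy of D₂, or trivial.
  simple-determined : ∀ A (A∈JIDL₁ : A ∈ᵛ JIDL₁) → JIDL₁Laws.IsSimple A A∈JIDL₁ → ∀ s t →
    (∀ k → Embedding (Cᵈᵖ (2 + k)) A → Cᵈᵖ (2 + k) ⊨ s ≐ t) →
    (Embedding D₂ A → D₂ ⊨ s ≐ t) →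
    A ⊨ s ≐ t
  simple-determined A A∈JIDL₁ simple s t C⊨ D₂⊨ =
    [ fixpoint , (λ no-fixpoint → chain (λ c c≈cᵈ → no-fixpoint (c , c≈cᵈ))) ]′ (toSum em)
    where
    open JIDL₁Laws A A∈JIDL₁
    open SimpleLaws A A∈JIDL₁ simple

    chain : (∀ c → ¬ c ≈ c ᵈ) → A ⊨ s ≐ t
    chain no-fixpoint = ChainLaws.finitely-determined A isDStHChain em s t C⊨
      where open NoFixpoint no-fixpoint

    square : ¬ ⊥ ≈ ⊤ → ∀ c → c ≈ c ᵈ → A ⊨ s ≐ t
    square ⊥≉⊤ c c≈cᵈ ρ = begin
      ⟦ A ⟧ s ρ                        ≈⟨ ⟦⟧-local A s (λ i _ → proj₂ (point (ρ i))) ⟩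
      ⟦ A ⟧ s (λ i → to (σ i))         ≈⟨ ⊨-image D₂-embedding s t (D₂⊨ D₂-embedding) σ ⟩
      ⟦ A ⟧ t (λ i → to (σ i))         ≈⟨ ⟦⟧-local A t (λ i _ → proj₂ (point (ρ i))) ⟨
      ⟦ A ⟧ t ρ                        ∎
      where
      open Fixpoint ⊥≉⊤ c c≈cᵈ renaming (D₂-embedding-surjective to point)
      open Embedding D₂-embedding using (to)
      open ≈-Reasoning (setoid A)
      σ : ℕ → Bool × Bool
      σ i = proj₁ (point (ρ i))

    fixpoint : (∃ λ c → c ≈ c ᵈ) → A ⊨ s ≐ t
    fixpoint (c , c≈cᵈ) = [ trivial , (λ ⊥≉⊤ → square ⊥≉⊤ c c≈cᵈ) ]′ (toSum (em {⊥ ≈ ⊤}))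
      where
      trivial : ⊥ ≈ ⊤ → A ⊨ s ≐ t
      trivial ⊥≈⊤ ρ = Eq.trans (≈⊥ _) (Eq.sym (≈⊥ _))
        where
        ≈⊥ : ∀ x → x ≈ ⊥
        ≈⊥ x = ≤⊥⇒≈⊥ (≤-trans (maximum x) (reflexive (Eq.sym ⊥≈⊤)))

  -- An identity that fails in A fails in D₂ or in a finite chain from the
  -- variety generated by A: separate its sides in a simple quotient of the
  -- subalgebra generated by the values of the variables.
  determined-by-generators : ∀ A → A ∈ᵛ JIDL₁ → ∀ s t →
    (∀ k → Inherits A (Cᵈᵖ (2 + k)) → Cᵈᵖ (2 + k) ⊨ s ≐ t) →
    (Inherits A D₂ → D₂ ⊨ s ≐ t) →
    A ⊨ s ≐ t
  determined-by-generators A A∈JIDL₁ s t C⊨ D₂⊨ ρ = decidable-stable em λ s≉t →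
    let open JIDL₁Laws.Ultrafilter T T∈JIDL₁ em terms terms-exhaustive s t s≉t

        A⊨⇒Q⊨ : Inherits A quotient
        A⊨⇒Q⊨ e A⊨e = ⊨-quotient e (A⊨⇒T⊨ e A⊨e)

        inherits : ∀ B → Embedding B quotient → Inherits A B
        inherits B h e A⊨e = ⊨-embedding h e (A⊨⇒Q⊨ e A⊨e)

        Q⊨ : quotient ⊨ s ≐ t
        Q⊨ = simple-determined quotient (λ e a → A⊨⇒Q⊨ e (A∈JIDL₁ e a)) quotient-simple s t
          (λ k h → C⊨ k (inherits _ h)) (λ h → D₂⊨ (inherits _ h))

        eq : ∀ r → ⟦ quotient ⟧ r var ≡ r
        eq r = ≡.trans (⟦⟧-quotient r var) (⟦⟧-generated A ρ r)

    in quotient-separates (≡.subst₂ (Algebra._≈_ quotient) (eq s) (eq t) (Q⊨ var))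
    where
    T : Algebra
    T = generated A ρ

    A⊨⇒T⊨ : Inherits A T
    A⊨⇒T⊨ = ⊨-embedding (generated-embedding A ρ)

    T∈JIDL₁ : T ∈ᵛ JIDL₁
    T∈JIDL₁ e a = A⊨⇒T⊨ e (A∈JIDL₁ e a)

-- A subvariety of JIDL₁ is determined by the finite chains and the square in it.
≤ᵛ-by-generators : ExcludedMiddle (lsuc 0ℓ) → ∀ V W → V ≤ᵛ JIDL₁ →
  (∀ k → Cᵈᵖ (2 + k) ∈ᵛ V → Cᵈᵖ (2 + k) ∈ᵛ W) → (D₂ ∈ᵛ V → D₂ ∈ᵛ W) → V ≤ᵛ W
≤ᵛ-by-generators em V W V≤ chains square A A∈V (s ≐ t) e∈W =
  determined-by-generators (lower-em em) A (V≤ A A∈V) s t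
    (λ k inh → chains k (λ e e∈V → inh e (A∈V e e∈V)) (s ≐ t) e∈W)
    (λ inh → square (λ e e∈V → inh e (A∈V e e∈V)) (s ≐ t) e∈W)

-- The generators

-- χ i m says that x_i, x_{i+1}, ..., x_{i+m} is not strictly decreasing.
χ : ℕ → ℕ → Term
χ i ℕ.zero    = 𝟎
χ i (ℕ.suc m) = (var i ⇒ var (ℕ.suc i)) ∨ χ (ℕ.suc i) m

-- An identity that holds in a finite chain exactly if it has at most n + 2
-- elements.
short : ℕ → Identity
short n = χ 0 (2 + n) ≐ 𝟏

-- A strictly decreasing run of m steps has to start at height m or above.
χ-or-long : ∀ N i m (ρ : ℕ → Fin (ℕ.suc N)) →
            ⟦ Cᵈᵖ (ℕ.suc N) ⟧ (χ i m) ρ ≡ fromℕ N ⊎ m ℕ.≤ Fin.toℕ (ρ i)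
χ-or-long N i ℕ.zero    ρ = inj₂ z≤n
χ-or-long N i (ℕ.suc m) ρ = result (≤-or-> (ρ i) (ρ (ℕ.suc i))) (χ-or-long N (ℕ.suc i) m ρ)
  where
  open FiniteChain N using (top; ≤-or->; ⇨-≤; ⊔-≤; ⊔-≥) renaming (_⊔_ to _⊔ᶜ_)
  step rest : Fin (ℕ.suc N)
  step = ⟦ Cᵈᵖ (ℕ.suc N) ⟧ (var i ⇒ var (ℕ.suc i)) ρ
  rest = ⟦ Cᵈᵖ (ℕ.suc N) ⟧ (χ (ℕ.suc i) m) ρ
  result : ρ i Fin.≤ ρ (ℕ.suc i) ⊎ ρ (ℕ.suc i) Fin.< ρ i →
           rest ≡ top ⊎ m ℕ.≤ Fin.toℕ (ρ (ℕ.suc i)) →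
           step ⊔ᶜ rest ≡ top ⊎ ℕ.suc m ℕ.≤ Fin.toℕ (ρ i)
  result (inj₁ p) _        = inj₁ (≡.trans (≡.cong (_⊔ᶜ rest) (⇨-≤ (ρ i) (ρ (ℕ.suc i)) p))
                                           (⊔-≥ top rest (Finₚ.≤fromℕ rest)))
  result (inj₂ _) (inj₁ q) = inj₁ (≡.trans (≡.cong (step ⊔ᶜ_) q) (⊔-≤ step top (Finₚ.≤fromℕ step)))
  result (inj₂ p) (inj₂ q) = inj₂ (ℕₚ.≤-<-trans q p)

Cᵈᵖ⊨short : ∀ n → Cᵈᵖ (2 + n) ⊨ short n
Cᵈᵖ⊨short n ρ = [ (λ p → p) , (λ q → contradiction (Finₚ.toℕ<n (ρ 0)) (ℕₚ.≤⇒≯ q)) ]′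
  (χ-or-long (ℕ.suc n) 0 (2 + n) ρ)

Cᵈᵖ⊭χ : ∀ N m → m ℕ.≤ ℕ.suc N → ¬ (Cᵈᵖ (2 + N) ⊨ χ 0 m ≐ 𝟏)
Cᵈᵖ⊭χ N m m≤ C⊨ = fails 0 m (ℕₚ.≤-trans (ℕₚ.≤-reflexive (ℕₚ.+-identityʳ m)) m≤) (C⊨ descending)
  where
  M : ℕ
  M = ℕ.suc N
  open FiniteChain M using (top; ⇨->; ⊔-≤; ⊔-≥) renaming (_⊔_ to _⊔ᶜ_; _⇨_ to _⇨ᶜ_)

  -- The chain read downwards from its top element.
  descending : ℕ → Fin (ℕ.suc M)
  descending i = fromℕ< (s≤s (ℕₚ.m∸n≤m M i))

  toℕ-descending : ∀ i → Fin.toℕ (descending i) ≡ M ℕ.∸ i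
  toℕ-descending i = Finₚ.toℕ-fromℕ< (s≤s (ℕₚ.m∸n≤m M i))

  descends : ∀ i → i ℕ.< M → descending (ℕ.suc i) Fin.< descending i
  descends i i<M = ≡.subst₂ ℕ._<_ (≡.sym (toℕ-descending (ℕ.suc i))) (≡.sym (toℕ-descending i))
    (ℕₚ.∸-monoʳ-< ℕₚ.≤-refl i<M)

  ≢top : ∀ (a b : Fin (ℕ.suc M)) → a Fin.< b → ¬ a ≡ top
  ≢top a b a<b ≡.refl = ℕₚ.<⇒≱ a<b (Finₚ.≤fromℕ b)

  ⊔≢top : ∀ a b → ¬ a ≡ top → ¬ b ≡ top → ¬ (a ⊔ᶜ b) ≡ top
  ⊔≢top a b a≢ b≢ p with Finₚ.≤-total a b
  ... | inj₁ a≤b = b≢ (≡.trans (≡.sym (⊔-≤ a b a≤b)) p)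
  ... | inj₂ b≤a = a≢ (≡.trans (≡.sym (⊔-≥ a b b≤a)) p)

  fails : ∀ i m → m + i ℕ.≤ M → ¬ ⟦ Cᵈᵖ (2 + N) ⟧ (χ i m) descending ≡ top
  fails i ℕ.zero    _ = λ ()
  fails i (ℕ.suc m) p = ⊔≢top
    (descending i ⇨ᶜ descending (ℕ.suc i)) (⟦ Cᵈᵖ (2 + N) ⟧ (χ (ℕ.suc i) m) descending)
    (λ q → ≢top _ _ step (≡.trans (≡.sym (⇨-> (descending i) (descending (ℕ.suc i)) step)) q))
    (fails (ℕ.suc i) m (ℕₚ.≤-trans (ℕₚ.≤-reflexive (ℕₚ.+-suc m i)) p))
    where
    step : descending (ℕ.suc i) Fin.< descending i
    step = descends i (ℕₚ.≤-trans (s≤s (ℕₚ.m≤n+m i m)) p)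

-- No three elements of the two-element chain are strictly decreasing, and D₂ is a
-- power of it as a Heyting algebra.
D₂⊨short : ∀ n → D₂ ⊨ short n
D₂⊨short n ρ = ≡.cong₂ _,_ (component (proj₁ (ρ 0)) (proj₁ (ρ 1)) (proj₁ (ρ 2)) _)
                     (component (proj₂ (ρ 0)) (proj₂ (ρ 1)) (proj₂ (ρ 2)) _)
  where
  component : ∀ p q r s → (not p Bool.∨ q) Bool.∨ ((not q Bool.∨ r) Bool.∨ s) ≡ true
  component false q     r s = ≡.refl
  component true  false r s = ≡.refl
  component true  true  r s = ≡.refl

D₂∈JIDL₁ : D₂ ∈ᵛ JIDL₁
D₂∈JIDL₁ _ (dqd (semiHeyting a)) = semi _ a
  where
  semi : ∀ e → SemiHeytingAxiom e → D₂ ⊨ e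
  semi _ ∨-comm    ρ = ≡.cong₂ _,_ (Boolₚ.∨-comm (proj₁ (ρ 0)) _) (Boolₚ.∨-comm (proj₂ (ρ 0)) _)
  semi _ ∨-assoc   ρ = ≡.cong₂ _,_ (Boolₚ.∨-assoc (proj₁ (ρ 0)) _ _)
                                 (Boolₚ.∨-assoc (proj₂ (ρ 0)) _ _)
  semi _ ∧-comm    ρ = ≡.cong₂ _,_ (Boolₚ.∧-comm (proj₁ (ρ 0)) _) (Boolₚ.∧-comm (proj₂ (ρ 0)) _)
  semi _ ∧-assoc   ρ = ≡.cong₂ _,_ (Boolₚ.∧-assoc (proj₁ (ρ 0)) _ _)
                                 (Boolₚ.∧-assoc (proj₂ (ρ 0)) _ _)
  semi _ ∨-absorbs ρ = ≡.cong₂ _,_ (Boolₚ.∨-abs-∧ _ _) (Boolₚ.∨-abs-∧ _ _)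
  semi _ ∧-absorbs ρ = ≡.cong₂ _,_ (Boolₚ.∧-abs-∨ _ _) (Boolₚ.∧-abs-∨ _ _)
  semi _ 𝟎-least   ρ = ≡.refl
  semi _ 𝟏-great   ρ = ≡.cong₂ _,_ (Boolₚ.∧-identityʳ _) (Boolₚ.∧-identityʳ _)
  semi _ sh₁       ρ = ≡.cong₂ _,_ (component (proj₁ (ρ 0)) _) (component (proj₂ (ρ 0)) _)
    where
    component : ∀ p q → p Bool.∧ (not p Bool.∨ q) ≡ p Bool.∧ q
    component false q = ≡.refl
    component true  q = ≡.refl
  semi _ sh₂       ρ = ≡.cong₂ _,_ (component (proj₁ (ρ 0)) _ _) (component (proj₂ (ρ 0)) _ _)
    where
    component : ∀ p q r →
      p Bool.∧ (not q Bool.∨ r) ≡ p Bool.∧ (not (p Bool.∧ q) Bool.∨ (p Bool.∧ r))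
    component false q r = ≡.refl
    component true  q r = ≡.refl
  semi _ sh₃       ρ = ≡.cong₂ _,_ (Boolₚ.∨-inverseˡ (proj₁ (ρ 0))) (Boolₚ.∨-inverseˡ (proj₂ (ρ 0)))
D₂∈JIDL₁ _ (dqd 𝟎′)   ρ = ≡.refl
D₂∈JIDL₁ _ (dqd 𝟏′)   ρ = ≡.refl
D₂∈JIDL₁ _ (dqd ∧-′)  ρ = ≡.cong₂ _,_ (component (proj₂ (ρ 0)) _) (component (proj₁ (ρ 0)) _)
  where
  component : ∀ p q → not (p Bool.∧ q) ≡ not p Bool.∨ not q
  component false q = ≡.refl
  component true  q = ≡.refl
D₂∈JIDL₁ _ (dqd ∨-′′) ρ = ≡.cong₂ _,_ (component (proj₁ (ρ 0)) _) (component (proj₂ (ρ 0)) _)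
  where
  component : ∀ p q → not (not (p Bool.∨ q)) ≡ not (not p) Bool.∨ not (not q)
  component false q = ≡.refl
  component true  q = ≡.refl
D₂∈JIDL₁ _ (dqd ′′-≤) ρ = ≡.cong₂ _,_ (component (proj₁ (ρ 0))) (component (proj₂ (ρ 0)))
  where
  component : ∀ p → not (not p) Bool.∧ p ≡ not (not p)
  component false = ≡.refl
  component true  = ≡.refl
D₂∈JIDL₁ _ jid        ρ = ≡.cong₂ _,_ (component (not (proj₂ (ρ 0))) _ _)
                                    (component (not (proj₁ (ρ 0))) _ _)
  where
  component : ∀ p q r → p Bool.∨ (not q Bool.∨ r) ≡ not (p Bool.∨ q) Bool.∨ (p Bool.∨ r)
  component false q r = ≡.refl
  component true  q r = ≡.refl
D₂∈JIDL₁ _ linear     ρ = ≡.cong₂ _,_ (component (proj₁ (ρ 0)) (proj₁ (ρ 1)))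
                                    (component (proj₂ (ρ 0)) (proj₂ (ρ 1)))
  where
  component : ∀ p q → (not p Bool.∨ q) Bool.∨ (not q Bool.∨ p) ≡ true
  component false q     = ≡.refl
  component true  false = ≡.refl
  component true  true  = ≡.refl
D₂∈JIDL₁ _ level₁     ρ = law (ρ 0)
  where
  open Algebra D₂ using () renaming (_∧_ to _⊓_; _⇒_ to _⇨_; _′ to _ᵈ; 𝟎 to o)
  law : ∀ a → (a ⊓ ((a ᵈ) ⇨ o)) ≡ ((((a ⊓ ((a ᵈ) ⇨ o)) ᵈ)) ⇨ o)
  law (false , false) = ≡.refl
  law (false , true)  = ≡.refl
  law (true  , false) = ≡.refl
  law (true  , true)  = ≡.refl

dualStone : Identity
dualStone = var 0 ′ ∧ (var 0 ′) ′ ≐ 𝟎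

D₂⊭dualStone : ¬ (D₂ ⊨ dualStone)
D₂⊭dualStone D₂⊨ with () ← D₂⊨ (λ _ → true , false)

Cᵈᵖ₂-embedding : Embedding (Cᵈᵖ 2) D₂
Cᵈᵖ₂-embedding = record
  { to        = to
  ; cong      = ≡.cong to
  ; injective = injective _ _
  ; ∨-homo    = λ where zero zero → ≡.refl ; zero (suc zero) → ≡.refl
                        (suc zero) zero → ≡.refl ; (suc zero) (suc zero) → ≡.refl
  ; ∧-homo    = λ where zero zero → ≡.refl ; zero (suc zero) → ≡.refl
                        (suc zero) zero → ≡.refl ; (suc zero) (suc zero) → ≡.refl
  ; ⇒-homo    = λ where zero zero → ≡.refl ; zero (suc zero) → ≡.refl
                        (suc zero) zero → ≡.refl ; (suc zero) (suc zero) → ≡.refl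
  ; ′-homo    = λ where zero → ≡.refl ; (suc zero) → ≡.refl
  ; 𝟎-homo    = ≡.refl
  ; 𝟏-homo    = ≡.refl
  }
  where
  to : Fin 2 → Bool × Bool
  to zero    = false , false
  to (suc _) = true , true
  injective : ∀ i j → to i ≡ to j → i ≡ j
  injective zero       zero       _ = ≡.refl
  injective (suc zero) (suc zero) _ = ≡.refl

Cᵈᵖ-downward : ∀ V {m n} → m ℕ.≤ n → Cᵈᵖ (2 + n) ∈ᵛ V → Cᵈᵖ (2 + m) ∈ᵛ V
Cᵈᵖ-downward V m≤n = go (ℕₚ.≤⇒≤′ m≤n)
  where
  go : ∀ {m n} → m ℕ.≤′ n → Cᵈᵖ (2 + n) ∈ᵛ V → Cᵈᵖ (2 + m) ∈ᵛ V
  go (ℕ.≤′-reflexive ≡.refl) C∈V = C∈V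
  go (ℕ.≤′-step {n} m≤′n)    C∈V = go m≤′n (∈ᵛ-embedding (Cᵈᵖ-embedding n) V C∈V)

-- The labels of the subvarieties

Labels : Lattice 0ℓ 0ℓ 0ℓ
Labels = 𝟏⊕ ((ω ⊕𝟏) ×ᴸ 𝟐)

Label : Set
Label = Lattice.Carrier Labels

private
  module P = Lattice Labels

pattern label n b = [ n , b ]₋

-- The variety with a given label.  The first coordinate n allows the chains with
-- at most n + 2 elements (all chains if it is ⊤⁺), the second tells whether D₂ is
-- included.
variety : Label → Variety
variety ⊥₋                     = Trivial
variety (label [ n ]⁺ false)   = 𝕍 ｛ Cᵈᵖ (2 + n) ｝
variety (label [ n ]⁺ true)    = 𝕍 ｛ Cᵈᵖ (2 + n) ｝ ∨ᵛ 𝕍 ｛ D₂ ｝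
variety (label ⊤⁺ false)       = DStHC
variety (label ⊤⁺ true)        = JIDL₁

-- The algebras that determine a subvariety: the finite chains with at least two
-- elements, and D₂.
data Generator : Set where
  chain  : ℕ → Generator
  square : Generator

algebra : Generator → Algebra
algebra (chain k) = Cᵈᵖ (2 + k)
algebra square    = D₂

-- The label of the variety generated by a generator; that of D₂ includes the
-- two-element chain, which is a subalgebra of D₂.
point : Generator → Label
point (chain k) = label [ k ]⁺ false
point square    = label [ 0 ]⁺ true

Cᵈᵖ∈JIDL₁ : ∀ k → Cᵈᵖ (2 + k) ∈ᵛ JIDL₁
Cᵈᵖ∈JIDL₁ k = ChainLaws.∈JIDL₁ _ (FiniteChain.isDStHChain (1 + k))

DStHC≤JIDL₁ : DStHC ≤ᵛ JIDL₁
DStHC≤JIDL₁ = 𝕍-least _ JIDL₁ λ A → ChainLaws.∈JIDL₁ A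

𝕍｛Cᵈᵖ｝≤ : ∀ k W → Cᵈᵖ (2 + k) ∈ᵛ W → 𝕍 ｛ Cᵈᵖ (2 + k) ｝ ≤ᵛ W
𝕍｛Cᵈᵖ｝≤ k W C∈W = 𝕍-least _ W λ { _ ≡.refl → C∈W }

𝕍｛D₂｝≤ : ∀ W → D₂ ∈ᵛ W → 𝕍 ｛ D₂ ｝ ≤ᵛ W
𝕍｛D₂｝≤ W D₂∈W = 𝕍-least _ W λ { _ ≡.refl → D₂∈W }

∨ᵛ-least : ∀ U V W → U ≤ᵛ W → V ≤ᵛ W → U ∨ᵛ V ≤ᵛ W
∨ᵛ-least U V W U≤W V≤W = 𝕍-least _ W λ A → [ U≤W A , V≤W A ]′

trivial-least : ∀ V → Trivial ≤ᵛ V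
trivial-least V A A∈ e e∈V ρ =
  A∈ _ x≐y ⟨ ⟦ A ⟧ (Identity.lhs e) ρ , ⟦ A ⟧ (Identity.rhs e) ρ , Algebra.𝟎 A ⟩

variety≤JIDL₁ : ∀ p → variety p ≤ᵛ JIDL₁
variety≤JIDL₁ ⊥₋                   = trivial-least JIDL₁
variety≤JIDL₁ (label [ n ]⁺ false) = 𝕍｛Cᵈᵖ｝≤ n JIDL₁ (Cᵈᵖ∈JIDL₁ n)
variety≤JIDL₁ (label [ n ]⁺ true)  = ∨ᵛ-least _ _ JIDL₁
  (𝕍｛Cᵈᵖ｝≤ n JIDL₁ (Cᵈᵖ∈JIDL₁ n)) (𝕍｛D₂｝≤ JIDL₁ D₂∈JIDL₁)
variety≤JIDL₁ (label ⊤⁺ false)     = DStHC≤JIDL₁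
variety≤JIDL₁ (label ⊤⁺ true)      = λ _ A∈ → A∈

≤⇒∈variety : ∀ g p → point g P.≤ p → algebra g ∈ᵛ variety p
≤⇒∈variety (chain k) (label [ n ]⁺ false) Inf.[ Sup.[ k≤n ] , _ ] =
  Cᵈᵖ-downward (𝕍 ｛ Cᵈᵖ (2 + n) ｝) k≤n (𝕍-contains _ _ ≡.refl)
≤⇒∈variety (chain k) (label [ n ]⁺ true)  Inf.[ Sup.[ k≤n ] , _ ] =
  𝕍-contains _ (Cᵈᵖ (2 + k)) (inj₁ (Cᵈᵖ-downward (𝕍 ｛ Cᵈᵖ (2 + n) ｝) k≤n (𝕍-contains _ _ ≡.refl)))
≤⇒∈variety (chain k) (label ⊤⁺ false)     _ =
  𝕍-contains _ (Cᵈᵖ (2 + k)) (FiniteChain.isDStHChain (1 + k))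
≤⇒∈variety (chain k) (label ⊤⁺ true)      _ = Cᵈᵖ∈JIDL₁ k
≤⇒∈variety square    (label [ n ]⁺ true)  _ = 𝕍-contains _ D₂ (inj₂ (𝕍-contains _ D₂ ≡.refl))
≤⇒∈variety square    (label ⊤⁺ true)      _ = D₂∈JIDL₁
≤⇒∈variety square    (label [ n ]⁺ false) Inf.[ _ , () ]
≤⇒∈variety square    (label ⊤⁺ false)     Inf.[ _ , () ]

private
  χ-bound : ∀ k n → Cᵈᵖ (2 + k) ⊨ short n → k ℕ.≤ n
  χ-bound k n C⊨ = ℕₚ.≮⇒≥ λ n<k → Cᵈᵖ⊭χ k (2 + n) (s≤s n<k) C⊨

  𝕍｛Cᵈᵖ｝⊨dualStone : ∀ n A → A ∈ᵛ 𝕍 ｛ Cᵈᵖ (2 + n) ｝ → A ⊨ dualStone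
  𝕍｛Cᵈᵖ｝⊨dualStone n A A∈ =
    A∈ dualStone λ { _ ≡.refl → IsDStHChain.isDualStone (FiniteChain.isDStHChain (1 + n)) }

  DStHC⊨dualStone : ∀ A → A ∈ᵛ DStHC → A ⊨ dualStone
  DStHC⊨dualStone A A∈ = A∈ dualStone λ _ → IsDStHChain.isDualStone

D₂∉DStHC : ¬ D₂ ∈ᵛ DStHC
D₂∉DStHC D₂∈ = D₂⊭dualStone (DStHC⊨dualStone D₂ D₂∈)

∈variety⇒≤ : ∀ g p → algebra g ∈ᵛ variety p → point g P.≤ p
∈variety⇒≤ (chain k) ⊥₋ C∈
  with () ← C∈ (var 0 ≐ var 1) x≐y ⟨ zero , suc zero , zero ⟩
∈variety⇒≤ square    ⊥₋ D∈
  with () ← D∈ (var 0 ≐ var 1) x≐y ⟨ (true , true) , (true , false) , (true , true) ⟩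
∈variety⇒≤ (chain k) (label [ n ]⁺ false) C∈ =
  Inf.[ Sup.[ χ-bound k n (C∈ (short n) λ { _ ≡.refl → Cᵈᵖ⊨short n }) ] , Bool.b≤b ]
∈variety⇒≤ (chain k) (label [ n ]⁺ true) C∈ =
  Inf.[ Sup.[ χ-bound k n (C∈ (short n) λ where
    A (inj₁ A∈) → A∈ (short n) λ { _ ≡.refl → Cᵈᵖ⊨short n }
    A (inj₂ A∈) → A∈ (short n) λ { _ ≡.refl → D₂⊨short n }) ] , Bool.f≤t ]
∈variety⇒≤ (chain k) (label ⊤⁺ false) _ = Inf.[ (_ Sup.≤⊤⁺) , Bool.b≤b ]
∈variety⇒≤ (chain k) (label ⊤⁺ true)  _ = Inf.[ (_ Sup.≤⊤⁺) , Bool.f≤t ]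
∈variety⇒≤ square (label [ n ]⁺ false) D∈ = contradiction (𝕍｛Cᵈᵖ｝⊨dualStone n D₂ D∈) D₂⊭dualStone
∈variety⇒≤ square (label [ n ]⁺ true)  _  = Inf.[ Sup.[ z≤n ] , Bool.b≤b ]
∈variety⇒≤ square (label ⊤⁺ false)     D∈ = contradiction D∈ D₂∉DStHC
∈variety⇒≤ square (label ⊤⁺ true)      _  = Inf.[ (_ Sup.≤⊤⁺) , Bool.b≤b ]

-- Every label is the join of the labels of the generators below it.
≤-by-points : ∀ p q → (∀ g → point g P.≤ p → point g P.≤ q) → p P.≤ q
≤-by-points ⊥₋ q below = Inf.⊥₋≤ q
≤-by-points (label [ n ]⁺ false) q below = below (chain n) P.refl
≤-by-points (label [ n ]⁺ true) q below
  with q | below (chain n) Inf.[ Sup.[ ℕₚ.≤-refl ] , Bool.f≤t ]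
         | below square Inf.[ Sup.[ z≤n ] , Bool.b≤b ]
... | label _ _ | Inf.[ n≤m , _ ] | Inf.[ _ , true≤c ] = Inf.[ n≤m , true≤c ]
≤-by-points (label ⊤⁺ b) ⊥₋ below
  with () ← below (chain 0) Inf.[ (_ Sup.≤⊤⁺) , Boolₚ.≤-minimum b ]
≤-by-points (label ⊤⁺ b) (label [ m ]⁺ c) below
  with Inf.[ Sup.[ m<m ] , _ ] ← below (chain (ℕ.suc m)) Inf.[ (_ Sup.≤⊤⁺) , Boolₚ.≤-minimum b ]
  = contradiction m<m (ℕₚ.<-irrefl ≡.refl)
≤-by-points (label ⊤⁺ false) (label ⊤⁺ c) below = Inf.[ (_ Sup.≤⊤⁺) , Boolₚ.≤-minimum c ]
≤-by-points (label ⊤⁺ true)  (label ⊤⁺ c) below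
  with Inf.[ _ , t≤c ] ← below square Inf.[ (_ Sup.≤⊤⁺) , Bool.b≤b ] = Inf.[ (_ Sup.≤⊤⁺) , t≤c ]

-- The lattice of subvarieties

-- An order isomorphism between lattices is a lattice isomorphism.
order-iso⇒≅ : ∀ {a b ℓ₁ ℓ₂ m₁ m₂} (L : Lattice a ℓ₁ ℓ₂) (M : Lattice b m₁ m₂) →
  let module L = Lattice L ; module M = Lattice M in
  (f : L.Carrier → M.Carrier) (g : M.Carrier → L.Carrier) →
  (∀ {x y} → x L.≤ y → f x M.≤ f y) → (∀ {x y} → f x M.≤ f y → x L.≤ y) →
  (∀ y → f (g y) M.≈ y) → L ≅ M
order-iso⇒≅ L M f g mono reflects f∘g = f , record
  { isLatticeMonomorphism = record
    { isLatticeHomomorphism = record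
      { isRelHomomorphism = record { cong = f-cong }
      ; ∧-homo = λ x y → M.antisym
          (M.∧-greatest (mono (L.x∧y≤x x y)) (mono (L.x∧y≤y x y)))
          (≤f (L.∧-greatest (g≤ (M.x∧y≤x _ _)) (g≤ (M.x∧y≤y _ _))))
      ; ∨-homo = λ x y → M.antisym
          (f≤ (L.∨-least (≤g (M.x≤x∨y _ _)) (≤g (M.y≤x∨y _ _))))
          (M.∨-least (mono (L.x≤x∨y x y)) (mono (L.y≤x∨y x y)))
      }
    ; injective = λ p → L.antisym (reflects (M.reflexive p)) (reflects (M.reflexive (M.Eq.sym p)))
    }
  ; surjective = λ y → g y , λ z≈gy → M.Eq.trans (f-cong z≈gy) (f∘g y)
  }
  where
  module L = Lattice L
  module M = Lattice M
  f-cong : ∀ {x y} → x L.≈ y → f x M.≈ f y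
  f-cong p = M.antisym (mono (L.reflexive p)) (mono (L.reflexive (L.Eq.sym p)))
  ≤g : ∀ {x y} → f x M.≤ y → x L.≤ g y
  ≤g {x} {y} p = reflects (M.trans p (M.reflexive (M.Eq.sym (f∘g y))))
  g≤ : ∀ {x y} → y M.≤ f x → g y L.≤ x
  g≤ {x} {y} p = reflects (M.trans (M.reflexive (f∘g y)) p)
  f≤ : ∀ {x y} → x L.≤ g y → f x M.≤ y
  f≤ {x} {y} p = M.trans (mono p) (M.reflexive (f∘g y))
  ≤f : ∀ {x y} → g y L.≤ x → y M.≤ f x
  ≤f {x} {y} p = M.trans (M.reflexive (M.Eq.sym (f∘g y))) (mono p)

-- A label of V: the generators in V are those below the label.
HasLabel : Variety → Label → Set₁
HasLabel V p = ∀ g → algebra g ∈ᵛ V ⇔ point g P.≤ p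

variety-labelled : ∀ p → HasLabel (variety p) p
variety-labelled p g = mk⇔ (∈variety⇒≤ g p) (≤⇒∈variety g p)

-- The labels of finite height.
data Finite : Label → Set where
  bottom : Finite ⊥₋
  finite : ∀ n b → Finite (label [ n ]⁺ b)

-- The height of a finite label; the value 0 at the other labels plays no role.
rank : Label → ℕ
rank ⊥₋                   = 0
rank (label [ n ]⁺ false) = 1 + n
rank (label [ n ]⁺ true)  = 2 + n
rank (label ⊤⁺ _)         = 0

finite-downward : ∀ {p q} → p P.≤ q → Finite q → Finite p
finite-downward (Inf.⊥₋≤ _)                                bottom       = bottom
finite-downward (Inf.⊥₋≤ _)                                (finite n b) = bottom
finite-downward {label [ m ]⁺ b} Inf.[ Sup.[ _ ] , _ ]     (finite n c) = finite m b

rank-mono : ∀ {p q} → p P.≤ q → ¬ q P.≤ p → Finite q → rank p ℕ.< rank q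
rank-mono (Inf.⊥₋≤ _) q≰p bottom           = contradiction (Inf.⊥₋≤ _) q≰p
rank-mono (Inf.⊥₋≤ _) _   (finite n false) = s≤s z≤n
rank-mono (Inf.⊥₋≤ _) _   (finite n true)  = s≤s z≤n
rank-mono {label [ m ]⁺ false} Inf.[ Sup.[ m≤n ] , _ ] q≰p (finite n false) =
  s≤s (ℕₚ.≤∧≢⇒< m≤n λ { ≡.refl → q≰p P.refl })
rank-mono {label [ m ]⁺ false} Inf.[ Sup.[ m≤n ] , _ ] q≰p (finite n true) = s≤s (s≤s m≤n)
rank-mono {label [ m ]⁺ true} Inf.[ Sup.[ m≤n ] , _ ] q≰p (finite n true) =
  s≤s (s≤s (ℕₚ.≤∧≢⇒< m≤n λ { ≡.refl → q≰p P.refl }))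

rank-mono-≤ : ∀ {p q} → p P.≤ q → Finite q → rank p ℕ.≤ rank q
rank-mono-≤ (Inf.⊥₋≤ _)                                               _                = z≤n
rank-mono-≤ {label [ m ]⁺ false} Inf.[ Sup.[ m≤n ] , _ ] (finite n false) = s≤s m≤n
rank-mono-≤ {label [ m ]⁺ false} Inf.[ Sup.[ m≤n ] , _ ] (finite n true)  = s≤s (ℕₚ.m≤n⇒m≤1+n m≤n)
rank-mono-≤ {label [ m ]⁺ true}  Inf.[ Sup.[ m≤n ] , _ ] (finite n true)  = s≤s (s≤s m≤n)

𝕃 : Lattice _ _ _
𝕃 = 𝓛 JIDL₁

labelled : Label → Lattice.Carrier 𝕃
labelled p = variety p , variety≤JIDL₁ p

-- The varieties generated by Cᵈᵖ 2, Cᵈᵖ 3, ... form an infinite ascending chain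
-- below DStHC.
infinite-height : ∀ b V (V≤ : V ≤ᵛ JIDL₁) → V ≋ variety (label ⊤⁺ b) → InfiniteHeight 𝕃 (V , V≤)
infinite-height b V V≤ (_ , ω≤V) (N , bounded) = ℕₚ.<-irrefl ≡.refl (bounded (ℕ.suc N) record
  { elem       = λ i → labelled (chains (Fin.toℕ i))
  ; increasing = λ {i} {j} i<j →
        𝕍｛Cᵈᵖ｝≤ (Fin.toℕ i) (variety (chains (Fin.toℕ j)))
          (≤⇒∈variety (chain (Fin.toℕ i)) (chains (Fin.toℕ j))
            Inf.[ Sup.[ ℕₚ.<⇒≤ i<j ] , Bool.b≤b ])
      , λ (_ , j≤i) → ℕₚ.<⇒≱ i<j (chains-reflect (Fin.toℕ j) (Fin.toℕ i) j≤i)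
  ; below      = λ i A A∈ → ω≤V A
      (𝕍｛Cᵈᵖ｝≤ (Fin.toℕ i) (variety (label ⊤⁺ b))
        (≤⇒∈variety (chain (Fin.toℕ i)) (label ⊤⁺ b) Inf.[ (_ Sup.≤⊤⁺) , Boolₚ.≤-minimum b ]) A A∈)
  })
  where
  chains : ℕ → Label
  chains n = label [ n ]⁺ false
  chains-reflect : ∀ m n → variety (chains m) ≤ᵛ variety (chains n) → m ℕ.≤ n
  chains-reflect m n m≤n
    with Inf.[ Sup.[ p ] , _ ] ← ∈variety⇒≤ (chain m) (chains n)
           (m≤n (Cᵈᵖ (2 + m)) (𝕍-contains _ (Cᵈᵖ (2 + m)) ≡.refl)) = p

𝕍｛D₂｝≋ : 𝕍 ｛ D₂ ｝ ≋ variety (label [ 0 ]⁺ true)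
𝕍｛D₂｝≋ = 𝕍｛D₂｝≤ (variety (label [ 0 ]⁺ true)) (≤⇒∈variety square (label [ 0 ]⁺ true) P.refl)
       , ∨ᵛ-least _ _ (𝕍 ｛ D₂ ｝)
           (𝕍｛Cᵈᵖ｝≤ 0 (𝕍 ｛ D₂ ｝) (∈ᵛ-embedding Cᵈᵖ₂-embedding (𝕍 ｛ D₂ ｝) (𝕍-contains _ D₂ ≡.refl)))
           (λ _ A∈ → A∈)

≋-trans : ∀ {U V W} → U ≋ V → V ≋ W → U ≋ W
≋-trans (p , q) (r , s) = (λ A A∈ → r A (p A A∈)) , (λ A A∈ → q A (s A A∈))

module Classification (em : ExcludedMiddle (lsuc 0ℓ)) where

  -- A predicate that holds at 0 but not everywhere holds at some n and fails at
  -- n + 1.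
  turning-point : (Q : ℕ → Set₁) → Q 0 → ¬ (∀ n → Q n) → ∃ λ n → Q n × ¬ Q (ℕ.suc n)
  turning-point Q Q0 ¬∀Q = decidable-stable em λ none → ¬∀Q (all none)
    where
    all : ¬ (∃ λ n → Q n × ¬ Q (ℕ.suc n)) → ∀ n → Q n
    all none ℕ.zero    = Q0
    all none (ℕ.suc n) = decidable-stable em λ ¬Q → none (n , all none n , ¬Q)

  find-label : ∀ V → ∃ λ p → HasLabel V p
  find-label V with em {Cᵈᵖ 2 ∈ᵛ V}
  ... | no  C₂∉V = ⊥₋ , λ where
          (chain k) → mk⇔ (λ C∈V → contradiction (Cᵈᵖ-downward V z≤n C∈V) C₂∉V) (λ ())
          square    → mk⇔ (λ D∈V → contradiction (∈ᵛ-embedding Cᵈᵖ₂-embedding V D∈V) C₂∉V) (λ ())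
  ... | yes C₂∈V = let n , chains = height ; b , squares = width in label n b , λ where
          (chain k) → mk⇔ (λ C∈V → Inf.[ Equivalence.to (chains k) C∈V , Boolₚ.≤-minimum b ])
                          (λ { Inf.[ k≤n , _ ] → Equivalence.from (chains k) k≤n })
          square    → mk⇔ (λ D∈V →
                             Inf.[ Equivalence.to (chains 0) C₂∈V , Equivalence.to squares D∈V ])
                          (λ { Inf.[ _ , t≤b ] → Equivalence.from squares t≤b })
    where
    width : ∃ λ b → D₂ ∈ᵛ V ⇔ true Bool.≤ b
    width with em {D₂ ∈ᵛ V}
    ... | yes D∈V = true , mk⇔ (λ _ → Bool.b≤b) (λ _ → D∈V)
    ... | no  D∉V = false , mk⇔ (λ D∈V → contradiction D∈V D∉V) (λ ())

    height : ∃ λ n → ∀ k → Cᵈᵖ (2 + k) ∈ᵛ V ⇔ Lattice._≤_ (ω ⊕𝟏) [ k ]⁺ n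
    height with em {∀ k → Cᵈᵖ (2 + k) ∈ᵛ V}
    ... | yes all  = ⊤⁺ , λ k → mk⇔ (λ _ → _ Sup.≤⊤⁺) (λ _ → all k)
    ... | no  ¬all with turning-point (λ k → Cᵈᵖ (2 + k) ∈ᵛ V) C₂∈V ¬all
    ...   | n , C∈V , C∉V = [ n ]⁺ , λ k → mk⇔
              (λ Cₖ∈V → Sup.[ ℕₚ.≮⇒≥ (λ n<k → C∉V (Cᵈᵖ-downward V n<k Cₖ∈V)) ])
              (λ { Sup.[ k≤n ] → Cᵈᵖ-downward V k≤n C∈V })

  labelOf : Variety → Label
  labelOf V = proj₁ (find-label V)

  labelOf-labels : ∀ V → HasLabel V (labelOf V)
  labelOf-labels V = proj₂ (find-label V)

  ≤ᵛ⇒≤ : ∀ {V W p q} → HasLabel V p → HasLabel W q → V ≤ᵛ W → p P.≤ q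
  ≤ᵛ⇒≤ {p = p} {q} lV lW V≤W = ≤-by-points p q λ g g≤p →
    Equivalence.to (lW g) (V≤W (algebra g) (Equivalence.from (lV g) g≤p))

  ≤⇒≤ᵛ : ∀ {V W p q} → V ≤ᵛ JIDL₁ → HasLabel V p → HasLabel W q → p P.≤ q → V ≤ᵛ W
  ≤⇒≤ᵛ {V} {W} V≤ lV lW p≤q = ≤ᵛ-by-generators em V W V≤ (λ k → move (chain k)) (move square)
    where
    move : ∀ g → algebra g ∈ᵛ V → algebra g ∈ᵛ W
    move g g∈V = Equivalence.from (lW g) (P.trans (Equivalence.to (lV g) g∈V) p≤q)

  labelOf-variety : ∀ p → labelOf (variety p) P.≈ p
  labelOf-variety p = P.antisym
    (≤ᵛ⇒≤ (labelOf-labels (variety p)) (variety-labelled p) (λ _ A∈ → A∈))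
    (≤ᵛ⇒≤ (variety-labelled p) (labelOf-labels (variety p)) (λ _ A∈ → A∈))

  variety-labelOf : ∀ V → V ≤ᵛ JIDL₁ → V ≋ variety (labelOf V)
  variety-labelOf V V≤ =
      ≤⇒≤ᵛ V≤ (labelOf-labels V) (variety-labelled _) P.refl
    , ≤⇒≤ᵛ (variety≤JIDL₁ (labelOf V)) (variety-labelled _) (labelOf-labels V) P.refl

  isomorphism : 𝕃 ≅ Labels
  isomorphism = order-iso⇒≅ 𝕃 Labels (λ (V , _) → labelOf V) labelled
    (λ {S} {T} → ≤ᵛ⇒≤ (labelOf-labels (proj₁ S)) (labelOf-labels (proj₁ T)))
    (λ {S} {T} → ≤⇒≤ᵛ (proj₂ S) (labelOf-labels (proj₁ S)) (labelOf-labels (proj₁ T)))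
    labelOf-variety

  -- Along a chain of subvarieties the ranks of the labels strictly increase.
  finite-height : ∀ {p} → Finite p → ∀ V (V≤ : V ≤ᵛ JIDL₁) → V ≋ variety p →
                  FiniteHeight 𝕃 (V , V≤)
  finite-height {p} finite-p V V≤ (V≤p , _) = rank p , λ k c →
    let open ChainBelow c

        labels : Fin (ℕ.suc k) → Label
        labels i = labelOf (proj₁ (elem i))

        labels-label : ∀ i → HasLabel (proj₁ (elem i)) (labels i)
        labels-label i = labelOf-labels (proj₁ (elem i))

        labels≤ : ∀ i → labels i P.≤ p
        labels≤ i = ≤ᵛ⇒≤ (labels-label i) (variety-labelled p) (λ A A∈ → V≤p A (below i A A∈))

        rank-increasing : ∀ {i j} → i Fin.< j → rank (labels i) ℕ.< rank (labels j)
        rank-increasing {i} {j} i<j = let i≤j , i≉j = increasing i<j in rank-mono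
          (≤ᵛ⇒≤ (labels-label i) (labels-label j) i≤j)
          (λ j≤i → i≉j (i≤j , ≤⇒≤ᵛ (proj₂ (elem j)) (labels-label j) (labels-label i) j≤i))
          (finite-downward (labels≤ j) finite-p)

    in ℕₚ.≤-trans (increasing⇒≤ k (λ i → rank (labels i)) rank-increasing)
                  (rank-mono-≤ (labels≤ (fromℕ k)) finite-p)
    where
    increasing⇒≤ : ∀ k (r : Fin (ℕ.suc k) → ℕ) → (∀ {i j} → i Fin.< j → r i ℕ.< r j) →
                   k ℕ.≤ r (fromℕ k)
    increasing⇒≤ ℕ.zero    r inc = z≤n
    increasing⇒≤ (ℕ.suc k) r inc = ℕₚ.≤-<-trans
      (increasing⇒≤ k (λ i → r (Fin.inject₁ i)) λ {i} {j} i<j → inc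
        (≡.subst₂ ℕ._<_ (≡.sym (Finₚ.toℕ-inject₁ i)) (≡.sym (Finₚ.toℕ-inject₁ j)) i<j))
      (inc (s≤s (ℕₚ.≤-reflexive (Finₚ.toℕ-inject₁ (fromℕ k)))))

  infinite⇔ : ∀ V (V≤ : V ≤ᵛ JIDL₁) → InfiniteHeight 𝕃 (V , V≤) ⇔ (V ≋ JIDL₁ ⊎ V ≋ DStHC)
  infinite⇔ V V≤ = mk⇔ (λ inf → to inf (labelOf V) (variety-labelOf V V≤))
    [ infinite-height true V V≤ , infinite-height false V V≤ ]′
    where
    to : InfiniteHeight 𝕃 (V , V≤) → ∀ p → V ≋ variety p → V ≋ JIDL₁ ⊎ V ≋ DStHC
    to inf ⊥₋               V≋ = contradiction (finite-height bottom V V≤ V≋) inf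
    to inf (label [ n ]⁺ b) V≋ = contradiction (finite-height (finite n b) V V≤ V≋) inf
    to inf (label ⊤⁺ false) V≋ = inj₂ V≋
    to inf (label ⊤⁺ true)  V≋ = inj₁ V≋

  finite⇔ : ∀ V (V≤ : V ≤ᵛ JIDL₁) → ¬ (V ≋ Trivial) → FiniteHeight 𝕃 (V , V≤) ⇔
    (V ≋ 𝕍 ｛ D₂ ｝
     ⊎ (∃[ k ] V ≋ 𝕍 ｛ Cᵈᵖ (2 + k) ｝)
     ⊎ (∃[ k ] V ≋ 𝕍 ｛ Cᵈᵖ (2 + k) ｝ ∨ᵛ 𝕍 ｛ D₂ ｝))
  finite⇔ V V≤ nontrivial = mk⇔ (λ fin → to fin (labelOf V) (variety-labelOf V V≤)) λ where
      (inj₁ V≋)              → finite-height (finite 0 true) V V≤ (≋-trans V≋ 𝕍｛D₂｝≋)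
      (inj₂ (inj₁ (k , V≋))) → finite-height (finite k false) V V≤ V≋
      (inj₂ (inj₂ (k , V≋))) → finite-height (finite k true) V V≤ V≋
    where
    to : FiniteHeight 𝕃 (V , V≤) → ∀ p → V ≋ variety p → _
    to fin ⊥₋                   V≋ = contradiction V≋ nontrivial
    to fin (label [ n ]⁺ false) V≋ = inj₂ (inj₁ (n , V≋))
    to fin (label [ n ]⁺ true)  V≋ = inj₂ (inj₂ (n , V≋))
    to fin (label ⊤⁺ b)         V≋ = contradiction fin (infinite-height b V V≤ V≋)

corollary7p1 :
  ExcludedMiddle (lsuc 0ℓ) →
  (𝓛 JIDL₁ ≅ 𝟏⊕ ((ω ⊕𝟏) ×ᴸ 𝟐))
  × (DStHC ≤ᵛ JIDL₁
     × ¬ (JIDL₁ ≋ DStHC)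
     × (∀ V (V≤ : V ≤ᵛ JIDL₁) →
        InfiniteHeight (𝓛 JIDL₁) (V , V≤) ⇔ (V ≋ JIDL₁ ⊎ V ≋ DStHC)))
  × (∀ V (V≤ : V ≤ᵛ JIDL₁) → ¬ (V ≋ Trivial) →
     FiniteHeight (𝓛 JIDL₁) (V , V≤) ⇔
     (V ≋ 𝕍 ｛ D₂ ｝
      ⊎ (∃[ k ] V ≋ 𝕍 ｛ Cᵈᵖ (2 + k) ｝)
      ⊎ (∃[ k ] V ≋ 𝕍 ｛ Cᵈᵖ (2 + k) ｝ ∨ᵛ 𝕍 ｛ D₂ ｝)))
corollary7p1 em =
    isomorphism
  , (DStHC≤JIDL₁ , (λ (JIDL₁≤ , _) → D₂∉DStHC (JIDL₁≤ D₂ D₂∈JIDL₁)) , infinite⇔)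
  , finite⇔
  where open Classification em
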